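{- For every $\epsilon>0$, there is some $g$ such that $\gamma_e(G)\leq \epsilon\, n(G)$ for every cubic graph $G$ of girth at least $g$. Furthermore, for every $\alpha$ with $0<\alpha<\frac{2}{3\ln(2)}$, there are infinitely many cubic graphs $G$ with $\gamma_e(G)\leq \frac{3n(G)}{\ln(n(G))^{\alpha}}$. Here $n(G)$ denotes the order of $G$.
   Context: All graphs are finite, simple and undirected. For a graph $G$ and $S\subseteq V(G)$, and vertices $u,v$ with $u\in S$ or $v\in S$, let $\mathrm{dist}_{(G,S)}(u,v)$ be the minimum number of edges of a path $P$ in $G$ between $u$ and $v$ such that $S$ contains exactly one endvertex of $P$ and no internal vertex of $P$ (and $\infty$ if no such path exists; in particular $\mathrm{dist}_{(G,S)}(u,u)=0$ for $u\in S$). For a vertex $u$, let $w_{(G,S)}(u)=\sum_{v\in S}\left(\frac{1}{2}\right)^{\mathrm{dist}_{(G,S)}(u,v)-1}$ with $(1/2)^\infty=0$. The set $S$ is an exponential dominating set of $G$ if $w_{(G,S)}(u)\geq 1$ for every vertex $u$ of $G$. The exponential domination number $\gamma_e(G)$ is the minimum cardinality of an exponential dominating set of $G$. -}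

module Defs where

open import Data.Nat as ℕ using (ℕ; zero; suc; _≤_; _<_)
open import Data.Integer using (+_)
open import Data.Rational as ℚ using (ℚ; _/_; 0ℚ; 1ℚ; ½)
open import Data.Fin using (Fin; zero; suc; inject₁; fromℕ; toℕ)
open import Data.Fin.Subset using (Subset; ∣_∣)
open import Data.Vec using (lookup; tabulate)
open import Data.Bool using (Bool; true; false; if_then_else_)
open import Data.Maybe using (Maybe; just; nothing)
open import Data.Product using (Σ; ∃; _×_)
open import Data.Sum using (_⊎_)
open import Relation.Binary.PropositionalEquality using (_≡_; _≢_)
open import Relation.Nullary using (¬_)

record Graph (n : ℕ) : Set where
  field
    adj   : Fin n → Fin n → Bool
    sym   : ∀ u v → adj u v ≡ adj v u
    irrfl : ∀ u → adj u u ≡ false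

open Graph public

Adj : ∀ {n} → Graph n → Fin n → Fin n → Set
Adj G u v = adj G u v ≡ true

degree : ∀ {n} → Graph n → Fin n → ℕ
degree G u = ∣ tabulate (adj G u) ∣

Cubic : ∀ {n} → Graph n → Set
Cubic G = ∀ u → degree G u ≡ 3

record Cycle {n : ℕ} (G : Graph n) (m : ℕ) : Set where
  field
    long  : 3 ≤ suc m
    vtx   : Fin (suc m) → Fin n
    inj   : ∀ i j → vtx i ≡ vtx j → i ≡ j
    step  : ∀ (i : Fin m) → Adj G (vtx (inject₁ i)) (vtx (suc i))
    close : Adj G (vtx (fromℕ m)) (vtx zero)

GirthAtLeast : ∀ {n} → Graph n → ℕ → Set
GirthAtLeast G g = ∀ m → Cycle G m → g ≤ suc m

_∈S_ : ∀ {n} → Fin n → Subset n → Set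
v ∈S S = lookup S v ≡ true

record SPath {n : ℕ} (G : Graph n) (S : Subset n) (u v : Fin n) (d : ℕ) : Set where
  field
    vtx      : Fin (suc d) → Fin n
    start    : vtx zero ≡ u
    end      : vtx (fromℕ d) ≡ v
    inj      : ∀ i j → vtx i ≡ vtx j → i ≡ j
    step     : ∀ (i : Fin d) → Adj G (vtx (inject₁ i)) (vtx (suc i))
    oneEnd   : (u ∈S S × ¬ (v ∈S S)) ⊎ (¬ (u ∈S S) × v ∈S S)
    internal : ∀ (i : Fin (suc d)) → 0 < toℕ i → toℕ i < d → ¬ (vtx i ∈S S)

-- IsDist G S u v δ : δ = dist_(G,S)(u,v)  (nothing = ∞),
-- for u = v ∈ S the distance is 0 by convention.
IsDist : ∀ {n} → Graph n → Subset n → Fin n → Fin n → Maybe ℕ → Set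
IsDist G S u v nothing  = u ≢ v × (∀ d → ¬ SPath G S u v d)
IsDist G S u v (just d) =
  (u ≡ v × d ≡ 0) ⊎ (u ≢ v × SPath G S u v d × (∀ d′ → SPath G S u v d′ → d ≤ d′))

halfPow : ℕ → ℚ
halfPow zero    = 1ℚ
halfPow (suc k) = ½ ℚ.* halfPow k

-- (1/2)^(δ - 1), with (1/2)^∞ = 0
weightTerm : Maybe ℕ → ℚ
weightTerm nothing        = 0ℚ
weightTerm (just zero)    = + 2 / 1
weightTerm (just (suc k)) = halfPow k

sumFin : ∀ n → (Fin n → ℚ) → ℚ
sumFin zero    f = 0ℚ
sumFin (suc n) f = f zero ℚ.+ sumFin n (λ i → f (suc i))

weight : ∀ {n} → Subset n → (Fin n → Maybe ℕ) → ℚ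
weight {n} S δ = sumFin n (λ v → if lookup S v then weightTerm (δ v) else 0ℚ)

ExpDominating : ∀ {n} → Graph n → Subset n → Set
ExpDominating {n} G S =
  ∀ (u : Fin n) (δ : Fin n → Maybe ℕ) →
    (∀ v → v ∈S S → IsDist G S u v (δ v)) → 1ℚ ℚ.≤ weight S δ

IsExpDomNumber : ∀ {n} → Graph n → ℕ → Set
IsExpDomNumber G k =
  (Σ _ λ S → ExpDominating G S × ∣ S ∣ ≡ k) ×
  (∀ S → ExpDominating G S → k ≤ ∣ S ∣)

qpow : ℚ → ℕ → ℚ
qpow x zero    = 1ℚ
qpow x (suc k) = x ℚ.* qpow x k

expTerm : ℚ → ℕ → ℚ
expTerm t zero    = 1ℚ
expTerm t (suc k) = expTerm t k ℚ.* (t ℚ.* (+ 1 / suc k))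

expSum : ℚ → ℕ → ℚ
expSum t zero    = 0ℚ
expSum t (suc K) = expSum t K ℚ.+ expTerm t K

-- LnLt x t  means  ln x < t  (used for x ≥ 1), i.e. x < e^t with t ≥ 0;
-- since the partial sums of e^t increase to e^t for t ≥ 0, this is
-- x < Σ_{k<K} t^k/k! for some K.
LnLt : ℚ → ℚ → Set
LnLt x t = 0ℚ ℚ.≤ t × ∃ λ K → x ℚ.< expSum t K

nq : ℕ → ℚ
nq m = + m / 1

{-# OPTIONS --safe #-}
-- In a cubic graph of large girth the non-backtracking walks with j + 2 vertices from a vertex u are
-- injective, and those that first meet S in the same vertex agree up to that vertex.  So for u ∉ S the
-- weight of u is at least 2^(-j) times the number of these walks (out of 3·2^j) that meet S, and it suffices
-- that at least a third of the walks from every u ∉ S meet S.  By averaging, some vertex lies on at least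
-- a proportion ℓ / n of the ℓ-vertex walks not yet met, so a greedy set of about m n / ℓ vertices misses only
-- 2^(-m) of all walks; by Markov's inequality at most (3/2) n / 2^m vertices have too many missed walks, and
-- these are added to S.  For ℓ = m 2^m this gives γ_e ≤ (7/2) n / 2^m.
--
-- For the second part, e^(2/3) < 2 forces α < 1, so cubic graphs with girth of order log n suffice.  Take
-- two copies of the set of row vectors x = (1 + 3u , y) modulo 3^K and join x in the first copy to x·s in
-- the second, for three integer matrices s of determinant 2 whose reductions modulo 2 have rank one with
-- distinct kernels and images.  A cycle yields a product P of these matrices and their adjugates with
-- x P ≡ t x, t a power of 2 and det P = t², whence 3^K divides t (2t − tr P).  Modulo 2 the trace is a
-- product of non-vanishing pairings, so 2t − tr P is odd; hence |t (2t − tr P)| ≥ 3^K, while it is at most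
-- exponential in the length of the cycle.

module Submission where

open import Defs
open import Data.Bool using (Bool; true; false; if_then_else_; T; _∧_; _∨_; _xor_)
import Data.Bool as Bool
open import Data.Bool.Properties using (xor-identityʳ; ∧-comm)
open import Data.Empty using (⊥; ⊥-elim)
open import Data.Fin using (Fin; zero; suc; toℕ; fromℕ; fromℕ<; inject₁; splitAt; combine; remQuot; _↑ˡ_; _↑ʳ_)
import Data.Fin as Fin
import Data.Fin.Properties as Finₚ
open import Data.Fin.Induction using (<-weakInduction)
open import Data.Fin.Patterns using (0F; 1F; 2F)
open import Data.List using (List; []; _∷_; length; map; _++_; concatMap; filter; allFin; lookup; _ʳ++_)
import Data.List as List
open import Data.List.Properties using (length-++; length-ʳ++; ++-identityʳ)
open import Data.List.Membership.Propositional using (_∈_)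
open import Data.List.Membership.Propositional.Properties using (∈-∃++; ∈-filter⁺; ∈-allFin; ∈-lookup)
import Data.List.Membership.DecPropositional as DecMembership
open import Data.List.Relation.Unary.All as All using (All; []; _∷_)
import Data.List.Relation.Unary.All.Properties as Allₚ
open import Data.List.Relation.Unary.AllPairs using ([]; _∷_)
open import Data.List.Relation.Unary.Any using (here; there)
open import Data.List.Relation.Unary.Unique.Propositional using (Unique)
import Data.List.Relation.Unary.Unique.Propositional.Properties as Uniqueₚ
open import Data.Maybe using (just; nothing)
open import Data.Product using (Σ; ∃; _×_; _,_; proj₁; proj₂)
open import Data.Sum using (_⊎_; inj₁; inj₂; [_,_]′)
open import Data.Sum.Properties using (inj₂-injective)
open import Data.Unit using (tt)
import Data.Vec as Vec
open import Data.Vec.Properties using (lookup∘tabulate)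
open import Function using (_∘_)
open import Relation.Binary.PropositionalEquality using (_≡_; _≢_; refl; trans; cong; cong₂; subst; module ≡-Reasoning) renaming (sym to ≡-sym)
open import Relation.Nullary using (¬_; ¬?; yes; no; does; contradiction; from-yes)

-- Girth bounds from matrices usually rest on the freeness of the group that the matrices generate.
-- Here parity takes over that role: determinant 2 makes every generator singular modulo 2, and a
-- rank-one reduction survives multiplication as long as no generator meets its own adjugate. The
-- modulus must then be odd, so that 2 is invertible and the matrices act by bijections. With row
-- vectors instead of matrices as vertices, a closed walk yields only an eigenvector, hence the
-- condition on det(P - t) = t (2t - tr P) rather than on P - t itself; a coordinate of the
-- eigenvector must be invertible for this, which the form (1 + 3u , y) guarantees. For the
-- logarithmic bound the order must be at most exponential in the girth, but the other constants may
-- be crude: α < 1 leaves a spare factor 2^(m(q - p)), which outgrows every fixed power of m.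

-- Hitting sets by greedy averaging

module HittingSets where

  open import Data.Nat using (ℕ; zero; suc; _≤_; _+_; _*_; _^_; _≤?_; z≤n; s≤s)
  open import Data.Nat.Properties
  import Data.Nat.ListAction as ListAction
  open import Data.Nat.Tactic.RingSolver using (solve-∀)
  open import Algebra.Properties.Semiring.Sum +-*-semiring using (sum; sum-cong-≗; ∑-distrib-+; *-distribˡ-sum)

  sum-mono : ∀ {n} {f g : Fin n → ℕ} → (∀ i → f i ≤ g i) → sum f ≤ sum g
  sum-mono {zero}  f≤g = z≤n
  sum-mono {suc n} f≤g = +-mono-≤ (f≤g zero) (sum-mono (f≤g ∘ suc))

  sum-zero : ∀ {n} {f : Fin n → ℕ} → (∀ i → f i ≡ 0) → sum f ≡ 0
  sum-zero {zero}  f≡0 = refl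
  sum-zero {suc n} f≡0 = cong₂ _+_ (f≡0 zero) (sum-zero (f≡0 ∘ suc))

  δ[_,_] : ∀ {n} → Fin n → Fin n → Bool
  δ[ i , j ] = does (i Fin.≟ j)

  sum-δ : ∀ {n} (i : Fin n) c → sum (λ j → if δ[ i , j ] then c else 0) ≡ c
  sum-δ {suc n} zero    c = trans (cong (c +_) (sum-zero {n} {λ _ → 0} (λ _ → refl))) (+-identityʳ c)
  sum-δ {suc n} (suc i) c = trans (sum-cong-≗ shift) (sum-δ i c)
    where
    shift : ∀ j → (if δ[ suc i , suc j ] then c else 0) ≡ (if δ[ i , j ] then c else 0)
    shift j with i Fin.≟ j
    ... | yes _ = refl
    ... | no  _ = refl

  average : ∀ {n} (f : Fin (suc n) → ℕ) → ∃ λ i → sum f ≤ suc n * f i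
  average {zero}  f = zero , ≤-refl
  average {suc n} f with average (f ∘ suc)
  ... | i , Σ≤ with f zero ≤? f (suc i)
  ...   | yes le = suc i , +-mono-≤ le Σ≤
  ...   | no ¬le = zero , +-monoʳ-≤ (f zero) (≤-trans Σ≤ (*-monoʳ-≤ (suc n) (<⇒≤ (≰⇒> ¬le))))

  sumᴸ : ∀ {A : Set} → (A → ℕ) → List A → ℕ
  sumᴸ f xs = ListAction.sum (map f xs)

  sumᴸ-++ : ∀ {A : Set} (f : A → ℕ) xs ys → sumᴸ f (xs ++ ys) ≡ sumᴸ f xs + sumᴸ f ys
  sumᴸ-++ f []       ys = refl
  sumᴸ-++ f (x ∷ xs) ys = trans (cong (f x +_) (sumᴸ-++ f xs ys)) (≡-sym (+-assoc (f x) _ _))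

  sumᴸ-concatMap : ∀ {A B : Set} (f : B → ℕ) (g : A → List B) xs →
                   sumᴸ f (concatMap g xs) ≡ sumᴸ (λ x → sumᴸ f (g x)) xs
  sumᴸ-concatMap f g []       = refl
  sumᴸ-concatMap f g (x ∷ xs) =
    trans (sumᴸ-++ f (g x) (concatMap g xs)) (cong (sumᴸ f (g x) +_) (sumᴸ-concatMap f g xs))

  sum-sumᴸ : ∀ {n} {A : Set} (f : Fin n → A → ℕ) xs →
             sum (λ i → sumᴸ (f i) xs) ≡ sumᴸ (λ x → sum (λ i → f i x)) xs
  sum-sumᴸ {n} f []   = sum-zero {n} {λ _ → 0} (λ _ → refl)
  sum-sumᴸ f (x ∷ xs) =
    trans (∑-distrib-+ (λ i → f i x) _) (cong (sum (λ i → f i x) +_) (sum-sumᴸ f xs))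

  𝟙 : Bool → ℕ
  𝟙 b = if b then 1 else 0

  card : ∀ {n} → (Fin n → Bool) → ℕ
  card f = sum (λ i → 𝟙 (f i))

  _∪_ : ∀ {n} → (Fin n → Bool) → (Fin n → Bool) → Fin n → Bool
  (f ∪ g) i = f i ∨ g i

  card-∪ : ∀ {n} (f g : Fin n → Bool) → card (f ∪ g) ≤ card f + card g
  card-∪ f g = ≤-trans (sum-mono pointwise) (≤-reflexive (∑-distrib-+ (𝟙 ∘ f) (𝟙 ∘ g)))
    where
    pointwise : ∀ i → 𝟙 (f i ∨ g i) ≤ 𝟙 (f i) + 𝟙 (g i)
    pointwise i with f i
    ... | true  = s≤s z≤n
    ... | false = ≤-refl

  module _ {n : ℕ} where

    misses : (Fin n → Bool) → List (Fin n) → ℕ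
    misses f []      = 1
    misses f (x ∷ w) = if f x then 0 else misses f w

    avoiding : (Fin n → Bool) → List (List (Fin n)) → ℕ
    avoiding f = sumᴸ (misses f)

    occurrences : Fin n → List (Fin n) → ℕ
    occurrences v = sumᴸ (λ x → 𝟙 δ[ x , v ])

    misses-anti : ∀ {f g} → (∀ x → f x ≡ true → g x ≡ true) → ∀ w → misses g w ≤ misses f w
    misses-anti         f⊆g []      = ≤-refl
    misses-anti {f} {g} f⊆g (x ∷ w) with f x in fx
    ... | true  rewrite f⊆g x fx = z≤n
    ... | false with g x
    ...   | true  = z≤n
    ...   | false = misses-anti f⊆g w

    avoiding-anti : ∀ {f g} → (∀ x → f x ≡ true → g x ≡ true) → ∀ P → avoiding g P ≤ avoiding f P
    avoiding-anti f⊆g []      = z≤n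
    avoiding-anti f⊆g (w ∷ P) = +-mono-≤ (misses-anti f⊆g w) (avoiding-anti f⊆g P)

    occurrences-∉ : ∀ v w → All (v ≢_) w → occurrences v w ≡ 0
    occurrences-∉ v []      []        = refl
    occurrences-∉ v (x ∷ w) (v≢x ∷ p) with x Fin.≟ v
    ... | yes x≡v = contradiction (≡-sym x≡v) v≢x
    ... | no  _   = occurrences-∉ v w p

    -- A missed `w` is lost exactly when `v` occurs in it, and duplicate-freeness makes the number
    -- of occurrences 0 or 1. In a missed walk a repeated `v` would make the left side too large.
    misses-insert : ∀ f v w → Unique w →
      misses (f ∪ λ x → δ[ x , v ]) w + misses f w * occurrences v w ≤ misses f w
    misses-insert f v []      _        = ≤-refl
    misses-insert f v (x ∷ w) (x∉w ∷ u) with f x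
    ... | true  = z≤n
    ... | false with x Fin.≟ v
    ...   | no  _    = misses-insert f v w u
    ...   | yes refl rewrite occurrences-∉ v w x∉w = ≤-reflexive (*-identityʳ _)

    sum-occurrences : ∀ w → sum (λ v → occurrences v w) ≡ length w
    sum-occurrences []      = sum-zero {n} {λ _ → 0} (λ _ → refl)
    sum-occurrences (x ∷ w) =
      trans (∑-distrib-+ (λ v → 𝟙 δ[ x , v ]) _) (cong₂ _+_ (sum-δ x 1) (sum-occurrences w))

    through : (Fin n → Bool) → Fin n → List (List (Fin n)) → ℕ
    through f v = sumᴸ (λ w → misses f w * occurrences v w)

    module _ {ℓ : ℕ} where

      Path : List (Fin n) → Set
      Path w = Unique w × length w ≡ ℓ

      avoiding-insert : ∀ f v {P} → All Path P →
        avoiding (f ∪ λ x → δ[ x , v ]) P + through f v P ≤ avoiding f P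
      avoiding-insert f v []                    = z≤n
      avoiding-insert f v {w ∷ P} ((u , _) ∷ p) =
        ≤-trans (≤-reflexive (interchange (misses _ w) (avoiding _ P) _ (through f v P)))
                (+-mono-≤ (misses-insert f v w u) (avoiding-insert f v p))
        where
        interchange : ∀ a b c d → (a + b) + (c + d) ≡ (a + c) + (b + d)
        interchange = solve-∀

      sum-through : ∀ f {P} → All Path P → sum (λ v → through f v P) ≡ ℓ * avoiding f P
      sum-through f []                  = trans (sum-zero {n} {λ _ → 0} (λ _ → refl)) (≡-sym (*-zeroʳ ℓ))
      sum-through f {w ∷ P} ((_ , len) ∷ p) =
        trans (∑-distrib-+ (λ v → misses f w * occurrences v w) _)
        (trans (cong₂ _+_ (trans (≡-sym (*-distribˡ-sum (misses f w) (λ v → occurrences v w)))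
                          (trans (cong (misses f w *_) (trans (sum-occurrences w) len)) (*-comm (misses f w) ℓ)))
                          (sum-through f p))
               (≡-sym (*-distribˡ-+ ℓ (misses f w) (avoiding f P))))

  module _ {n ℓ : ℕ} {P : List (List (Fin (suc n)))} (paths : All (Path {ℓ = ℓ}) P) where

    private N = suc n

    -- Double counting: summed over `v`, `through f v P` counts each missed walk once per vertex,
    -- that is ℓ times. The division by `N` is cleared.
    popular : ∀ f → ∃ λ v →
      N * avoiding (f ∪ λ x → δ[ x , v ]) P + ℓ * avoiding f P ≤ N * avoiding f P
    popular f with average (λ v → through f v P)
    ... | v , Σ≤ = v , (begin
      N * avoiding f′ P + ℓ * avoiding f P                  ≡⟨ cong (N * avoiding f′ P +_) (sum-through f paths) ⟨
      N * avoiding f′ P + sum (λ v → through f v P)         ≤⟨ +-monoʳ-≤ (N * avoiding f′ P) Σ≤ ⟩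
      N * avoiding f′ P + N * through f v P                 ≡⟨ *-distribˡ-+ N (avoiding f′ P) _ ⟨
      N * (avoiding f′ P + through f v P)                   ≤⟨ *-monoʳ-≤ N (avoiding-insert f v paths) ⟩
      N * avoiding f P ∎)
      where
      open ≤-Reasoning
      f′ = f ∪ λ x → δ[ x , v ]

    -- Until half of the walks missed by `f` are met, every popular vertex meets at least a
    -- proportion ℓ / (2N) of that original number. Progress is therefore linear in `s`, which
    -- replaces an estimate of (1 - ℓ / N)^s; once half is reached the set is left alone.
    greedy : ∀ f s → ∃ λ f′ → card f′ ≤ card f + s ×
      (2 * avoiding f′ P ≤ avoiding f P ⊎
       s * ℓ * avoiding f P + 2 * (N * avoiding f′ P) ≤ 2 * (N * avoiding f P))
    greedy f zero = f , ≤-reflexive (≡-sym (+-identityʳ _)) , inj₂ ≤-refl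
    greedy f (suc s) with greedy f s
    ... | f′ , c , inj₁ done = f′ , ≤-trans c (+-monoʳ-≤ (card f) (n≤1+n s)) , inj₁ done
    ... | f′ , c , inj₂ q with 2 * avoiding f′ P ≤? avoiding f P
    ...   | yes done = f′ , ≤-trans c (+-monoʳ-≤ (card f) (n≤1+n s)) , inj₁ done
    ...   | no  many with popular f′
    ...     | v , pop = f″ , card-f″ , inj₂ (begin
      suc s * ℓ * A + 2 * (N * A″)               ≡⟨ split s ℓ A (2 * (N * A″)) ⟩
      s * ℓ * A + (ℓ * A + 2 * (N * A″))         ≤⟨ +-monoʳ-≤ (s * ℓ * A) (+-monoˡ-≤ _ (*-monoʳ-≤ ℓ (<⇒≤ (≰⇒> many)))) ⟩
      s * ℓ * A + (ℓ * (2 * A′) + 2 * (N * A″))  ≡⟨ cong (s * ℓ * A +_) (pull ℓ A′ (N * A″)) ⟩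
      s * ℓ * A + 2 * (N * A″ + ℓ * A′)          ≤⟨ +-monoʳ-≤ (s * ℓ * A) (*-monoʳ-≤ 2 pop) ⟩
      s * ℓ * A + 2 * (N * A′)                   ≤⟨ q ⟩
      2 * (N * A) ∎)
      where
      open ≤-Reasoning
      f″ = f′ ∪ λ x → δ[ x , v ]
      A = avoiding f P
      A′ = avoiding f′ P
      A″ = avoiding f″ P
      split : ∀ s ℓ A B → (1 + s) * ℓ * A + B ≡ s * ℓ * A + (ℓ * A + B)
      split = solve-∀
      pull : ∀ ℓ a b → ℓ * (2 * a) + 2 * b ≡ 2 * (b + ℓ * a)
      pull = solve-∀
      singleton : card (λ x → δ[ x , v ]) ≡ 1
      singleton = trans (sum-cong-≗ flip) (sum-δ v 1)
        where
        flip : ∀ x → 𝟙 δ[ x , v ] ≡ 𝟙 δ[ v , x ]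
        flip x with x Fin.≟ v | v Fin.≟ x
        ... | yes _   | yes _   = refl
        ... | no  _   | no  _   = refl
        ... | yes x≡v | no  v≢x = contradiction (≡-sym x≡v) v≢x
        ... | no  x≢v | yes v≡x = contradiction (≡-sym v≡x) x≢v
      card-f″ : card f″ ≤ card f + suc s
      card-f″ = begin
        card f″                              ≤⟨ card-∪ f′ (λ x → δ[ x , v ]) ⟩
        card f′ + card (λ x → δ[ x , v ])    ≡⟨ cong (card f′ +_) singleton ⟩
        card f′ + 1                          ≤⟨ +-monoˡ-≤ 1 c ⟩
        card f + s + 1                       ≡⟨ trans (+-assoc (card f) s 1) (cong (card f +_) (+-comm s 1)) ⟩
        card f + suc s ∎

    halve : ∀ f s → N ≤ s * ℓ → ∃ λ f′ → card f′ ≤ card f + s × 2 * avoiding f′ P ≤ avoiding f P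
    halve f s N≤sℓ with greedy f s
    ... | f′ , c , inj₁ done = f′ , c , done
    ... | f′ , c , inj₂ q    = f′ , c , *-cancelˡ-≤ N (+-cancelˡ-≤ (N * A) _ _ (begin
      N * A + N * (2 * A′)       ≤⟨ +-monoˡ-≤ _ (*-monoˡ-≤ A N≤sℓ) ⟩
      s * ℓ * A + N * (2 * A′)   ≡⟨ cong (s * ℓ * A +_) (swap N A′) ⟩
      s * ℓ * A + 2 * (N * A′)   ≤⟨ q ⟩
      2 * (N * A)                ≡⟨ cong (N * A +_) (+-identityʳ (N * A)) ⟩
      N * A + N * A ∎))
      where
      open ≤-Reasoning
      A = avoiding f P
      A′ = avoiding f′ P
      swap : ∀ a b → a * (2 * b) ≡ 2 * (a * b)
      swap = solve-∀

    hitting-set : ∀ s m → N ≤ s * ℓ → ∃ λ f → card f ≤ m * s × 2 ^ m * avoiding f P ≤ avoiding (λ _ → false) P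
    hitting-set s zero    N≤sℓ = (λ _ → false) , ≤-reflexive (sum-zero {N} {λ _ → 0} (λ _ → refl)) ,
      ≤-reflexive (+-identityʳ _)
    hitting-set s (suc m) N≤sℓ with hitting-set s m N≤sℓ
    ... | f , c , a with halve f s N≤sℓ
    ...   | f′ , c′ , h = f′ , ≤-trans c′ (≤-trans (+-monoˡ-≤ s c) (≤-reflexive (+-comm (m * s) s))) , (begin
      2 * 2 ^ m * avoiding f′ P     ≡⟨ swap (2 ^ m) (avoiding f′ P) ⟩
      2 ^ m * (2 * avoiding f′ P)   ≤⟨ *-monoʳ-≤ (2 ^ m) h ⟩
      2 ^ m * avoiding f P          ≤⟨ a ⟩
      avoiding (λ _ → false) P ∎)
      where
      open ≤-Reasoning
      swap : ∀ a b → 2 * a * b ≡ a * (2 * b)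
      swap = solve-∀

-- Non-backtracking walks and their first hits

module Walks where

  open import Data.Fin.Subset using (∣_∣)
  open import Data.Nat using (ℕ; zero; suc; _≤_; _<_; _+_; _*_; _^_; z≤n; s≤s)
  open import Data.Nat.Properties
  open import Data.Nat.Tactic.RingSolver using (solve-∀)
  open import Algebra.Properties.Semiring.Sum +-*-semiring using (sum)
  open HittingSets

  card-tabulate : ∀ {n} (f : Fin n → Bool) → ∣ Vec.tabulate f ∣ ≡ card f
  card-tabulate {zero}  f = refl
  card-tabulate {suc n} f with f zero
  ... | true  = cong suc (card-tabulate (f ∘ suc))
  ... | false = card-tabulate (f ∘ suc)

  length-filter-tabulate : ∀ {n k} (f : Fin k → Bool) (g : Fin n → Fin k) →
    length (filter (λ v → f v Bool.≟ true) (List.tabulate g)) ≡ card (f ∘ g)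
  length-filter-tabulate {zero}  f g = refl
  length-filter-tabulate {suc n} f g with f (g zero)
  ... | true  = cong suc (length-filter-tabulate f (g ∘ suc))
  ... | false = length-filter-tabulate f (g ∘ suc)

  lookup-injective : ∀ {A : Set} {xs : List A} → Unique xs → ∀ i j → lookup xs i ≡ lookup xs j → i ≡ j
  lookup-injective (p ∷ u) zero    zero    eq = refl
  lookup-injective (p ∷ u) zero    (suc j) eq = contradiction eq (All.lookup p (∈-lookup j))
  lookup-injective (p ∷ u) (suc i) zero    eq = contradiction (≡-sym eq) (All.lookup p (∈-lookup i))
  lookup-injective (p ∷ u) (suc i) (suc j) eq = cong suc (lookup-injective u i j eq)

  unique-prefix : ∀ {A : Set} {x : A} pre {post} → Unique (pre ++ x ∷ post) → Unique (x ∷ pre)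
  unique-prefix []        u = [] ∷ []
  unique-prefix (y ∷ pre) (y∉ ∷ u) with unique-prefix pre u | Allₚ.++⁻ʳ pre y∉
  ... | x∉ ∷ u′ | y≢x ∷ _ = ((y≢x ∘ ≡-sym) ∷ x∉) ∷ Allₚ.++⁻ˡ pre y∉ ∷ u′

  unique-ʳ++⁻ : ∀ {A : Set} (xs : List A) {ys} → Unique (xs ʳ++ ys) → Unique ys
  unique-ʳ++⁻ []       u = u
  unique-ʳ++⁻ (x ∷ xs) u with unique-ʳ++⁻ xs u
  ... | _ ∷ u′ = u′

  ʳ++-disjoint : ∀ {A : Set} {v : A} {xs ys} → Unique (xs ʳ++ ys) → v ∈ xs → v ∈ ys → ⊥
  ʳ++-disjoint {xs = x ∷ xs} u (here refl) v∈ys =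
    Uniqueₚ.Unique[x∷xs]⇒x∉xs (unique-ʳ++⁻ xs u) v∈ys
  ʳ++-disjoint {xs = x ∷ xs} u (there v∈xs) v∈ys = ʳ++-disjoint {xs = xs} u v∈xs (there v∈ys)

  sumᴸ-+ : ∀ {A : Set} (f g : A → ℕ) xs → sumᴸ f xs + sumᴸ g xs ≡ sumᴸ (λ x → f x + g x) xs
  sumᴸ-+ f g []       = refl
  sumᴸ-+ f g (x ∷ xs) = trans (interchange (f x) _ (g x) _) (cong (f x + g x +_) (sumᴸ-+ f g xs))
    where
    interchange : ∀ a b c d → (a + b) + (c + d) ≡ (a + c) + (b + d)
    interchange = solve-∀

  sumᴸ-cong : ∀ {A : Set} {f g : A → ℕ} → (∀ x → f x ≡ g x) → ∀ xs → sumᴸ f xs ≡ sumᴸ g xs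
  sumᴸ-cong eq []       = refl
  sumᴸ-cong eq (x ∷ xs) = cong₂ _+_ (eq x) (sumᴸ-cong eq xs)

  sumᴸ-const : ∀ {A : Set} {f : A → ℕ} {k} {xs} → All (λ x → f x ≡ k) xs → sumᴸ f xs ≡ length xs * k
  sumᴸ-const []         = refl
  sumᴸ-const (eq ∷ eqs) = cong₂ _+_ eq (sumᴸ-const eqs)

  -- No two distinct entries can both carry the certificate `Q`, so at most one summand survives. It
  -- is applied to the branches at a vertex, only one of which can first meet the set in a given
  -- `v`.
  sumᴸ-exclusive : ∀ {A : Set} (f : A → ℕ) (Q : A → Set) → (∀ {x y} → x ≢ y → Q x → Q y → ⊥) →
    ∀ {xs} → Unique xs → All (λ x → f x ≡ 0 ⊎ Q x) xs →
    sumᴸ f xs ≡ 0 ⊎ ∃ λ x → Q x × sumᴸ f xs ≡ f x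
  sumᴸ-exclusive {A} f Q excl = go
    where
    allZero : ∀ {x} → Q x → ∀ {ys} → All (x ≢_) ys → All (λ y → f y ≡ 0 ⊎ Q y) ys → sumᴸ f ys ≡ 0
    allZero q []          []               = refl
    allZero q (x≢y ∷ ≢s) (inj₁ z ∷ cases) = cong₂ _+_ z (allZero q ≢s cases)
    allZero q (x≢y ∷ ≢s) (inj₂ r ∷ cases) = ⊥-elim (excl x≢y q r)
    go : ∀ {xs} → Unique xs → All (λ x → f x ≡ 0 ⊎ Q x) xs →
         sumᴸ f xs ≡ 0 ⊎ ∃ λ x → Q x × sumᴸ f xs ≡ f x
    go []       []               = inj₁ refl
    go {x ∷ xs} (x∉ ∷ u) (inj₂ q ∷ cases) =
      inj₂ (x , q , trans (cong (f x +_) (allZero q x∉ cases)) (+-identityʳ (f x)))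
    go {x ∷ xs} (x∉ ∷ u) (inj₁ z ∷ cases) with go u cases
    ... | inj₁ z′           = inj₁ (cong₂ _+_ z z′)
    ... | inj₂ (y , q , eq) = inj₂ (y , q , trans (cong (_+ sumᴸ f xs) z) eq)

  module _ {n : ℕ} where

    without : Fin n → List (Fin n) → List (Fin n)
    without x = filter (λ y → ¬? (y Fin.≟ x))

    without-∉ : ∀ {x} {xs} → All (x ≢_) xs → length (without x xs) ≡ length xs
    without-∉ []          = refl
    without-∉ {x} {y ∷ ys} (x≢y ∷ x∉) with y Fin.≟ x
    ... | yes y≡x = contradiction (≡-sym y≡x) x≢y
    ... | no  _   = cong suc (without-∉ x∉)

    length-without : ∀ {x} {xs} → Unique xs → x ∈ xs → suc (length (without x xs)) ≡ length xs
    length-without {x} {y ∷ ys} (y∉ ∷ u) x∈ with y Fin.≟ x | x∈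
    ... | yes refl | _          = cong suc (without-∉ y∉)
    ... | no  y≢x  | here x≡y   = contradiction (≡-sym x≡y) y≢x
    ... | no  _    | there x∈ys = cong suc (length-without u x∈ys)

    avoiding-map : ∀ f c (P : List (List (Fin n))) →
      avoiding f (map (c ∷_) P) ≡ (if f c then 0 else avoiding f P)
    avoiding-map f c []      with f c
    ... | true  = refl
    ... | false = refl
    avoiding-map f c (w ∷ P) with f c | avoiding-map f c P
    ... | true  | eq = eq
    ... | false | eq = cong (misses f w +_) eq

  concatMap⁺ : ∀ {A B : Set} {P : B → Set} {g : A → List B} {xs} →
               All (λ x → All P (g x)) xs → All P (concatMap g xs)
  concatMap⁺ []       = []
  concatMap⁺ (p ∷ ps) = Allₚ.++⁺ p (concatMap⁺ ps)

  -- Non-backtracking walks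

  module _ {n : ℕ} (G : Graph n) where

    private
      V = Fin n

    data NonBacktracking : List V → Set where
      []   : NonBacktracking []
      [-]  : ∀ {x} → NonBacktracking (x ∷ [])
      edge : ∀ {x y} → Adj G x y → NonBacktracking (x ∷ y ∷ [])
      turn : ∀ {x y z w} → Adj G x y → x ≢ z → NonBacktracking (y ∷ z ∷ w) → NonBacktracking (x ∷ y ∷ z ∷ w)

    nb-tail : ∀ {x w} → NonBacktracking (x ∷ w) → NonBacktracking w
    nb-tail [-]         = []
    nb-tail (edge _)       = [-]
    nb-tail (turn _ _ r) = r

    nb-head : ∀ {x y w} → NonBacktracking (x ∷ y ∷ w) → Adj G x y
    nb-head (edge a)       = a
    nb-head (turn a _ _) = a

    nb-step : ∀ x ws {zs} → NonBacktracking (x ∷ ws ++ zs) →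
              ∀ (i : Fin (length ws)) → Adj G (lookup (x ∷ ws) (inject₁ i)) (lookup ws i)
    nb-step x (y ∷ ws) r zero    = nb-head r
    nb-step x (y ∷ ws) r (suc i) = nb-step y ws (nb-tail r) i

    nb-close : ∀ x ws {z zs} → NonBacktracking (x ∷ ws ++ z ∷ zs) →
               Adj G (lookup (x ∷ ws) (fromℕ (length ws))) z
    nb-close x []       r = nb-head r
    nb-close x (y ∷ ws) r = nb-close y ws (nb-tail r)

    Adj-sym : ∀ {x y} → Adj G x y → Adj G y x
    Adj-sym {x} {y} a = trans (Graph.sym G y x) a

    Adj-irrefl : ∀ {x} → ¬ Adj G x x
    Adj-irrefl {x} a with trans (≡-sym a) (Graph.irrfl G x)
    ... | ()

    -- As `x` occurs only once in the tail, the part up to its return has no other repetition. A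
    -- return after one step contradicts irreflexivity and one after two steps the turn condition,
    -- so at least three vertices remain.
    returns→cycle : ∀ x pre {post} → NonBacktracking (x ∷ pre ++ x ∷ post) → Unique (pre ++ x ∷ post) →
                    Cycle G (length pre)
    returns→cycle x []            r u = contradiction (nb-head r) Adj-irrefl
    returns→cycle x (y ∷ [])      (turn _ x≢x _) u = contradiction refl x≢x
    returns→cycle x pre@(_ ∷ _ ∷ _) r u = record
      { long  = s≤s (s≤s (s≤s z≤n))
      ; vtx   = lookup (x ∷ pre)
      ; inj   = lookup-injective (unique-prefix pre u)
      ; step  = nb-step x pre r
      ; close = nb-close x pre r
      }

    nb-unique : ∀ {g} → GirthAtLeast G g → ∀ {w} → NonBacktracking w → length w ≤ g → Unique w
    nb-unique girth {[]}    r len = []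
    nb-unique {g} girth {x ∷ w} r len with nb-unique girth (nb-tail r) (≤-trans (n≤1+n _) len) | DecMembership._∈?_ Fin._≟_ x w
    ... | u | no  x∉w = Allₚ.¬Any⇒All¬ w x∉w ∷ u
    ... | u | yes x∈w with ∈-∃++ x∈w
    ...   | pre , post , refl = contradiction (girth (length pre) (returns→cycle x pre r u)) (<⇒≱ short)
      where
      -- The walk lists `x` twice and the cycle only once, so the inequality is strict even for a
      -- walk on exactly `g` vertices.
      short : suc (length pre) < g
      short = ≤-trans (s≤s (≤-trans (s≤s (m≤m+n (length pre) (length post)))
        (≤-reflexive (trans (≡-sym (+-suc (length pre) (length post)))
                            (≡-sym (length-++ pre)))))) len

    -- Two walks leaving `x` are glued by reversing one of them; the last hypothesis says that the
    -- new turn at `x` does not backtrack.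
    nb-ʳ++ : ∀ {x y acc} w → NonBacktracking (x ∷ w) → NonBacktracking (x ∷ y ∷ acc) →
             (∀ {z w′} → w ≡ z ∷ w′ → z ≢ y) → NonBacktracking (w ʳ++ (x ∷ y ∷ acc))
    nb-ʳ++ []          r s diverge = s
    nb-ʳ++ (z ∷ [])    r s diverge = turn (Adj-sym (nb-head r)) (diverge refl) s
    nb-ʳ++ (z ∷ w@(_ ∷ _)) (turn a x≢z′ r) s diverge =
      nb-ʳ++ w r (turn (Adj-sym a) (diverge refl) s) (λ { refl z′≡x → x≢z′ (≡-sym z′≡x) })

    neighbours : V → List V
    neighbours u = filter (λ v → adj G u v Bool.≟ true) (allFin n)

    neighbours-unique : ∀ u → Unique (neighbours u)
    neighbours-unique u = Uniqueₚ.filter⁺ _ (Uniqueₚ.allFin⁺ n)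

    neighbours-Adj : ∀ u → All (Adj G u) (neighbours u)
    neighbours-Adj u = Allₚ.all-filter _ (allFin n)

    length-neighbours : Cubic G → ∀ u → length (neighbours u) ≡ 3
    length-neighbours cubic u =
      trans (length-filter-tabulate (adj G u) (λ i → i)) (trans (≡-sym (card-tabulate (adj G u))) (cubic u))

    successors : V → V → List V
    successors p c = without p (neighbours c)

    successors-unique : ∀ p c → Unique (successors p c)
    successors-unique p c = Uniqueₚ.filter⁺ _ (neighbours-unique c)

    successors-Adj : ∀ p c → All (λ y → Adj G c y × y ≢ p) (successors p c)
    successors-Adj p c = All.zip (Allₚ.filter⁺ _ (neighbours-Adj c) , Allₚ.all-filter _ (neighbours c))

    length-successors : Cubic G → ∀ {p c} → Adj G p c → length (successors p c) ≡ 2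
    length-successors cubic {p} {c} a = suc-injective (trans
      (length-without (neighbours-unique c) (∈-filter⁺ _ (∈-allFin p) (Adj-sym a)))
      (length-neighbours cubic c))

    walks : V → V → ℕ → List (List V)
    walks p c zero    = (c ∷ []) ∷ []
    walks p c (suc j) = concatMap (λ y → map (c ∷_) (walks c y j)) (successors p c)

    walksFrom : ℕ → V → List (List V)
    walksFrom j u = concatMap (λ y → map (u ∷_) (walks u y j)) (neighbours u)

    IsWalk : V → ℕ → List V → Set
    IsWalk p j w = NonBacktracking (p ∷ w) × length w ≡ suc j

    nb-cons : ∀ {p c w} → Adj G p c → NonBacktracking (c ∷ w) → (∀ {z w′} → w ≡ z ∷ w′ → z ≢ p) →
              NonBacktracking (p ∷ c ∷ w)
    nb-cons {w = []}    a r ≢p = edge a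
    nb-cons {w = _ ∷ _} a r ≢p = turn a (≢p refl ∘ ≡-sym) r

    StartsAt : V → List V → Set
    StartsAt c w = ∃ λ w′ → w ≡ c ∷ w′

    walks-start : ∀ p c j → All (StartsAt c) (walks p c j)
    walks-start p c zero    = ([] , refl) ∷ []
    walks-start p c (suc j) = concatMap⁺ (All.universal
      (λ y → Allₚ.map⁺ (All.universal (λ w → w , refl) (walks c y j))) (successors p c))

    walks-isWalk : ∀ {p c} j → Adj G p c → All (IsWalk p j) (walks p c j)
    walks-isWalk zero    a = (edge a , refl) ∷ []
    walks-isWalk {p} {c} (suc j) a = concatMap⁺ (All.map
      (λ {y} (b , y≢p) → Allₚ.map⁺ (All.zipWith
        (λ { ((r , len) , (w′ , refl)) → nb-cons a r (λ { refl → y≢p }) , cong suc len })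
        (walks-isWalk j b , walks-start c y j)))
      (successors-Adj p c))

    walksFrom-nb : ∀ j u → All (λ w → NonBacktracking w × length w ≡ suc (suc j)) (walksFrom j u)
    walksFrom-nb j u = concatMap⁺ (All.map
      (λ {y} b → Allₚ.map⁺ (All.map (λ (r , len) → r , cong suc len) (walks-isWalk j b)))
      (neighbours-Adj u))

    -- The number of j-step continuations of the step p → c whose first vertex in f is v.
    firstHits : (V → Bool) → V → V → V → ℕ → ℕ
    firstHits f v p c zero    = if f c then (if δ[ c , v ] then 1 else 0) else 0
    firstHits f v p c (suc j) =
      if f c then (if δ[ c , v ] then 2 ^ suc j else 0)
      else sumᴸ (λ y → firstHits f v c y j) (successors p c)

    firstHitsFrom : (V → Bool) → V → ℕ → V → ℕ
    firstHitsFrom f v j u = sumᴸ (λ y → firstHits f v u y j) (neighbours u)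

    branch : V → ℕ → List V → List (List V)
    branch c j ys = concatMap (λ y → map (c ∷_) (walks c y j)) ys

    avoiding-branch : ∀ f c j ys → f c ≡ false →
      avoiding f (branch c j ys) ≡ sumᴸ (λ y → avoiding f (walks c y j)) ys
    avoiding-branch f c j ys fc = trans (sumᴸ-concatMap (misses f) _ ys) (sumᴸ-cong eq ys)
      where
      eq : ∀ y → avoiding f (map (c ∷_) (walks c y j)) ≡ avoiding f (walks c y j)
      eq y = trans (avoiding-map f c (walks c y j)) (cong (if_then 0 else avoiding f (walks c y j)) fc)

    avoiding-branch-hit : ∀ f c j ys → f c ≡ true → avoiding f (branch c j ys) ≡ 0
    avoiding-branch-hit f c j ys fc = trans (sumᴸ-concatMap (misses f) _ ys)
      (trans (sumᴸ-const (All.universal eq ys)) (*-zeroʳ (length ys)))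
      where
      eq : ∀ y → avoiding f (map (c ∷_) (walks c y j)) ≡ 0
      eq y = trans (avoiding-map f c (walks c y j)) (cong (if_then 0 else avoiding f (walks c y j)) fc)

    module _ (cubic : Cubic G) (f : V → Bool) where

      -- Each of the 2^j continuations either avoids `f` or has exactly one first vertex in `f`, so
      -- the counts over all `v` and the missed walks partition them. Cubicity enters as two
      -- successors per step.
      hits+misses : ∀ {p c} j → Adj G p c →
        sum (λ v → firstHits f v p c j) + avoiding f (walks p c j) ≡ 2 ^ j

      branch-total : ∀ c j ys → All (Adj G c) ys → f c ≡ false →
        sum (λ v → sumᴸ (λ y → firstHits f v c y j) ys) + avoiding f (branch c j ys) ≡ length ys * 2 ^ j
      branch-total c j ys as fc =
        trans (cong₂ _+_ (sum-sumᴸ (λ v y → firstHits f v c y j) ys) (avoiding-branch f c j ys fc))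
        (trans (sumᴸ-+ _ _ ys) (sumᴸ-const (All.map (hits+misses j) as)))

      hits+misses {p} {c} zero a with f c
      ... | true  = trans (+-identityʳ _) (sum-δ c 1)
      ... | false = cong (_+ 1) (sum-zero {n} {λ _ → 0} (λ _ → refl))
      hits+misses {p} {c} (suc j) a with f c in fc
      ... | true  = trans (cong₂ _+_ (sum-δ c (2 ^ suc j)) (avoiding-branch-hit f c j (successors p c) fc)) (+-identityʳ _)
      ... | false = trans (branch-total c j (successors p c) (All.map proj₁ (successors-Adj p c)) fc)
                          (cong (_* 2 ^ j) (length-successors cubic a))

      hits+missesFrom : ∀ j u → f u ≡ false →
        sum (λ v → firstHitsFrom f v j u) + avoiding f (walksFrom j u) ≡ 3 * 2 ^ j
      hits+missesFrom j u fu = trans (branch-total u j (neighbours u) (neighbours-Adj u) fu)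
                                     (cong (_* 2 ^ j) (length-neighbours cubic u))

    -- A first passage from `c` to `v`: only the last vertex lies in `f`, as in the paths that
    -- define dist_(G,S). The vertex `p` before `c` is kept to forbid backtracking.
    data Route (f : V → Bool) (v : V) : V → V → List V → Set where
      stop : ∀ {p} → f v ≡ true → Route f v p v (v ∷ [])
      via  : ∀ {p c y w} → f c ≡ false → Adj G c y → y ≢ p → Route f v c y w → Route f v p c (c ∷ w)

    module _ {f : V → Bool} {v : V} where

      route-∈ : ∀ {p c w} → Route f v p c w → v ∈ w
      route-∈ (stop _)     = here refl
      route-∈ (via _ _ _ r) = there (route-∈ r)

      route-f : ∀ {p c w} → Route f v p c w → f v ≡ true
      route-f (stop fv)    = fv
      route-f (via _ _ _ r) = route-f r

      route-start : ∀ {p c w} → Route f v p c w → StartsAt c w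
      route-start (stop _)     = [] , refl
      route-start (via _ _ _ _) = _ , refl

      route-nb : ∀ {p c w} → Adj G p c → Route f v p c w → NonBacktracking (p ∷ w)
      route-nb a (stop _) = edge a
      route-nb a (via _ b y≢p r) with route-start r | route-nb b r
      ... | _ , refl | nb = turn a (y≢p ∘ ≡-sym) nb

      route-end : ∀ {p c w} → Route f v p c w → ∀ x → lookup (x ∷ w) (fromℕ (length w)) ≡ v
      route-end (stop _)         x = refl
      route-end (via {c = c} _ _ _ r) x = route-end r c

      route-internal : ∀ {p c w} → Route f v p c w → ∀ i → suc (toℕ i) < length w → f (lookup w i) ≡ false
      route-internal (stop _) zero (s≤s ())
      route-internal (via fc _ _ r) zero    _       = fc
      route-internal (via fc _ _ r) (suc i) (s≤s l) = route-internal r i l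

      module _ {g : ℕ} (girth : GirthAtLeast G g) where

        -- The reversed `w`, then `c`, then `w′` form a non-backtracking walk with `v` at both ends;
        -- on at most `g` vertices it would have to be injective.
        route-branch-unique : ∀ {c y y′ w w′} → Adj G c y → Adj G c y′ → y ≢ y′ →
          Route f v c y w → Route f v c y′ w′ → length w + suc (length w′) ≤ g → ⊥
        route-branch-unique {w = w} {w′} a a′ y≢y′ r r′ len with route-start r | route-start r′
        ... | _ , refl | _ , refl = ʳ++-disjoint
          (nb-unique girth (nb-ʳ++ w (route-nb a r) (route-nb a′ r′) (λ { refl → y≢y′ }))
                     (≤-trans (≤-reflexive (length-ʳ++ w)) len))
          (route-∈ r) (there (route-∈ r′))

        -- With d = `length w` the last condition reads k ≤ 2^(j + 1 - d): all counted continuations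
        -- share the route `w`, and this is the number of ways to prolong it to `suc j` vertices.
        Reached : V → V → ℕ → ℕ → Set
        Reached p c j k = ∃ λ w → Route f v p c w × length w ≤ suc j × k * 2 ^ length w ≤ 2 ^ suc j

        -- Two routes of at most `suc j` vertices glued at `c` have at most 2j + 3 vertices, which
        -- is the length bound assumed here. Hence at most one branch contributes, and the sum
        -- inherits its route.
        pick : ∀ c j → suc (suc j) + suc j ≤ g → ∀ ys → Unique ys →
          All (λ y → Adj G c y × (firstHits f v c y j ≡ 0 ⊎ Reached c y j (firstHits f v c y j))) ys →
          sumᴸ (λ y → firstHits f v c y j) ys ≡ 0 ⊎
          ∃ λ y → y ∈ ys × Reached c y j (sumᴸ (λ y → firstHits f v c y j) ys)
        pick c j len ys u cases
          with sumᴸ-exclusive (λ y → firstHits f v c y j)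
                 (λ y → y ∈ ys × Adj G c y × Reached c y j (firstHits f v c y j))
                 (λ { x≢y (_ , a , w , r , l , _) (_ , a′ , w′ , r′ , l′ , _) →
                      route-branch-unique a a′ x≢y r r′
                        (≤-trans (≤-reflexive (+-suc (length w) (length w′))) (≤-trans (s≤s (+-mono-≤ l l′)) len)) })
                 u (All.tabulate λ y∈ → tag y∈ (All.lookup cases y∈))
          where
          tag : ∀ {y} → y ∈ ys → Adj G c y × (firstHits f v c y j ≡ 0 ⊎ Reached c y j (firstHits f v c y j)) →
                firstHits f v c y j ≡ 0 ⊎ (y ∈ ys × Adj G c y × Reached c y j (firstHits f v c y j))
          tag y∈ (a , inj₁ z) = inj₁ z
          tag y∈ (a , inj₂ r) = inj₂ (y∈ , a , r)
        ... | inj₁ z = inj₁ z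
        ... | inj₂ (y , (y∈ , a , r) , eq) = inj₂ (y , y∈ , subst (Reached c y j) (≡-sym eq) r)

        reached : ∀ {p c} j → suc j + j ≤ g → firstHits f v p c j ≡ 0 ⊎ Reached p c j (firstHits f v p c j)
        reached {p} {c} zero len with f c in fc
        ... | false = inj₁ refl
        ... | true with c Fin.≟ v
        ...   | no  _    = inj₁ refl
        ...   | yes refl = inj₂ (_ , stop fc , ≤-refl , ≤-refl)
        reached {p} {c} (suc j) len with f c in fc
        reached {p} {c} (suc j) len | true with c Fin.≟ v
        ...   | no  _    = inj₁ refl
        ...   | yes refl = inj₂ (_ , stop fc , s≤s z≤n , ≤-reflexive (*-comm (2 ^ suc j) 2))
        reached {p} {c} (suc j) len | false
          with pick c j len (successors p c) (successors-unique p c)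
                 (All.map (λ (a , _) → a , reached j (≤-trans (+-mono-≤ (n≤1+n (suc j)) (n≤1+n j)) len)) (successors-Adj p c))
        ... | inj₁ z = inj₁ z
        ... | inj₂ (y , y∈ , w , r , l , b) with All.lookup (successors-Adj p c) y∈
        ...   | a , y≢p = inj₂ (c ∷ w , via fc a y≢p r , s≤s l , bound)
          where
          k = sumᴸ (λ y → firstHits f v c y j) (successors p c)
          shift : ∀ a b → a * (2 * b) ≡ 2 * (a * b)
          shift = solve-∀
          bound : k * (2 * 2 ^ length w) ≤ 2 * 2 ^ suc j
          bound = ≤-trans (≤-reflexive (shift k (2 ^ length w))) (*-monoʳ-≤ 2 b)

        reachedFrom : ∀ j u → suc (suc j) + suc j ≤ g →
          firstHitsFrom f v j u ≡ 0 ⊎ ∃ λ y → Adj G u y × Reached u y j (firstHitsFrom f v j u)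
        reachedFrom j u len
          with pick u j len (neighbours u) (neighbours-unique u)
                 (All.map (λ a → a , reached j (≤-trans (+-mono-≤ (n≤1+n (suc j)) (n≤1+n j)) len)) (neighbours-Adj u))
        ... | inj₁ z = inj₁ z
        ... | inj₂ (y , y∈ , r) = inj₂ (y , All.lookup (neighbours-Adj u) y∈ , r)

        route-path : ∀ {u y w} → f u ≡ false → Adj G u y → Route f v u y w → suc (length w) ≤ g →
                     SPath G (Vec.tabulate f) u v (length w)
        route-path {u} {y} {w} fu a r len = record
          { vtx      = lookup (u ∷ w)
          ; start    = refl
          ; end      = route-end r u
          ; inj      = lookup-injective (nb-unique girth nb len)
          ; step     = nb-step u w {[]} (subst (λ z → NonBacktracking (u ∷ z)) (≡-sym (++-identityʳ w)) nb)
          ; oneEnd   = inj₂ (outside fu , trans (lookup∘tabulate f v) (route-f r))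
          ; internal = λ { (suc i) _ i<d → outside (route-internal r i i<d) }
          }
          where
          nb = route-nb a r
          outside : ∀ {x} → f x ≡ false → ¬ (x ∈S Vec.tabulate f)
          outside {x} fx x∈ with trans (≡-sym fx) (trans (≡-sym (lookup∘tabulate f x)) x∈)
          ... | ()

-- From walk counts to exponential domination

module Domination where

  open import Data.Fin.Subset using (∣_∣)
  open import Data.Nat using (ℕ; zero; suc; _≤_; _<_; _+_; _*_; _^_; _<ᵇ_; z≤n; s≤s)
  open import Data.Nat.Properties
  open import Data.Nat.DivMod using (_/_; m≡m%n+[m/n]*n; m/n*n≤m; m%n<n)
  open import Data.Nat.Tactic.RingSolver using (solve-∀)
  import Data.Integer as ℤ
  import Data.Integer.Properties as ℤₚ
  open import Data.Rational as ℚ using (ℚ; 0ℚ; 1ℚ; ½)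
  import Data.Rational.Properties as ℚₚ
  import Data.Rational.Unnormalised as ℚᵘ
  import Data.Rational.Unnormalised.Properties as ℚᵘₚ
  open import Algebra.Properties.Semiring.Sum +-*-semiring using (sum; *-distribʳ-sum)
  open import Algebra.Bundles using (CommutativeMonoid)
  open import Algebra.Properties.CommutativeSemigroup (CommutativeMonoid.commutativeSemigroup ℚₚ.*-1-commutativeMonoid) using (interchange)
  open HittingSets
  open Walks

  toℚᵘ-nq : ∀ m → ℚ.toℚᵘ (nq m) ℚᵘ.≃ ℚᵘ.mkℚᵘ (ℤ.+ m) 0
  toℚᵘ-nq m = ℚₚ.toℚᵘ-fromℚᵘ (ℚᵘ.mkℚᵘ (ℤ.+ m) 0)

  nq-+ : ∀ a b → nq (a + b) ≡ nq a ℚ.+ nq b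
  nq-+ a b = ℚₚ.toℚᵘ-injective (begin
    ℚ.toℚᵘ (nq (a + b))                    ≈⟨ toℚᵘ-nq (a + b) ⟩
    ℚᵘ.mkℚᵘ (ℤ.+ (a + b)) 0                  ≈⟨ ℚᵘ.*≡* (cong (ℤ._* ℤ.+ 1) (≡-sym (cong₂ ℤ._+_ (ℤₚ.*-identityʳ (ℤ.+ a)) (ℤₚ.*-identityʳ (ℤ.+ b))))) ⟩
    ℚᵘ.mkℚᵘ (ℤ.+ a) 0 ℚᵘ.+ ℚᵘ.mkℚᵘ (ℤ.+ b) 0   ≈⟨ ℚᵘₚ.+-cong (toℚᵘ-nq a) (toℚᵘ-nq b) ⟨
    ℚ.toℚᵘ (nq a) ℚᵘ.+ ℚ.toℚᵘ (nq b)       ≈⟨ ℚₚ.toℚᵘ-homo-+ (nq a) (nq b) ⟨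
    ℚ.toℚᵘ (nq a ℚ.+ nq b) ∎)
    where open ℚᵘₚ.≃-Reasoning

  nq-* : ∀ a b → nq (a * b) ≡ nq a ℚ.* nq b
  nq-* a b = ℚₚ.toℚᵘ-injective (begin
    ℚ.toℚᵘ (nq (a * b))                    ≈⟨ toℚᵘ-nq (a * b) ⟩
    ℚᵘ.mkℚᵘ (ℤ.+ (a * b)) 0                  ≈⟨ ℚᵘ.*≡* (cong (ℤ._* ℤ.+ 1) (ℤₚ.pos-* a b)) ⟩
    ℚᵘ.mkℚᵘ (ℤ.+ a) 0 ℚᵘ.* ℚᵘ.mkℚᵘ (ℤ.+ b) 0   ≈⟨ ℚᵘₚ.*-cong (toℚᵘ-nq a) (toℚᵘ-nq b) ⟨
    ℚ.toℚᵘ (nq a) ℚᵘ.* ℚ.toℚᵘ (nq b)       ≈⟨ ℚₚ.toℚᵘ-homo-* (nq a) (nq b) ⟨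
    ℚ.toℚᵘ (nq a ℚ.* nq b) ∎)
    where open ℚᵘₚ.≃-Reasoning

  nq-mono-≤ : ∀ {a b} → a ≤ b → nq a ℚ.≤ nq b
  nq-mono-≤ {a} {b} a≤b = ℚₚ.toℚᵘ-cancel-≤
    (ℚᵘₚ.≤-respˡ-≃ (ℚᵘₚ.≃-sym (toℚᵘ-nq a)) (ℚᵘₚ.≤-respʳ-≃ (ℚᵘₚ.≃-sym (toℚᵘ-nq b))
      (ℚᵘ.*≤* (ℤₚ.*-monoʳ-≤-nonNeg (ℤ.+ 1) (ℤ.+≤+ a≤b)))))

  nq-cancel-< : ∀ {a b} → nq a ℚ.< nq b → a < b
  nq-cancel-< {a} {b} a<b = ≰⇒> (λ b≤a → ℚₚ.<-irrefl refl (ℚₚ.<-≤-trans a<b (nq-mono-≤ b≤a)))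

  0≤nq : ∀ a → 0ℚ ℚ.≤ nq a
  0≤nq a = nq-mono-≤ {0} {a} z≤n

  ≤-*ʳ : ∀ {p q r} → 0ℚ ℚ.≤ r → p ℚ.≤ q → p ℚ.* r ℚ.≤ q ℚ.* r
  ≤-*ʳ {r = r} 0≤r = ℚₚ.*-monoʳ-≤-nonNeg r {{ℚ.nonNegative 0≤r}}

  ≤-*ˡ : ∀ {p q r} → 0ℚ ℚ.≤ r → p ℚ.≤ q → r ℚ.* p ℚ.≤ r ℚ.* q
  ≤-*ˡ {r = r} 0≤r = ℚₚ.*-monoˡ-≤-nonNeg r {{ℚ.nonNegative 0≤r}}

  *-nonNeg : ∀ {p q} → 0ℚ ℚ.≤ p → 0ℚ ℚ.≤ q → 0ℚ ℚ.≤ p ℚ.* q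
  *-nonNeg {p} {q} 0≤p 0≤q = ℚₚ.≤-trans (ℚₚ.≤-reflexive (≡-sym (ℚₚ.*-zeroˡ q))) (≤-*ʳ 0≤q 0≤p)

  0≤½ : 0ℚ ℚ.≤ ½
  0≤½ = ℚₚ.nonNegative⁻¹ ½

  halfPow-nonNeg : ∀ k → 0ℚ ℚ.≤ halfPow k
  halfPow-nonNeg zero    = ℚₚ.nonNegative⁻¹ 1ℚ
  halfPow-nonNeg (suc k) = *-nonNeg 0≤½ (halfPow-nonNeg k)

  halfPow-suc≤ : ∀ k → halfPow (suc k) ℚ.≤ halfPow k
  halfPow-suc≤ k = ℚₚ.≤-trans (≤-*ʳ {½} {1ℚ} (halfPow-nonNeg k) (ℚₚ.≤ᵇ⇒≤ _)) (ℚₚ.≤-reflexive (ℚₚ.*-identityˡ (halfPow k)))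

  halfPow≤1 : ∀ k → halfPow k ℚ.≤ 1ℚ
  halfPow≤1 zero    = ℚₚ.≤-refl
  halfPow≤1 (suc k) = ℚₚ.≤-trans (halfPow-suc≤ k) (halfPow≤1 k)

  halfPow-anti : ∀ {a b} → a ≤ b → halfPow b ℚ.≤ halfPow a
  halfPow-anti {b = b} z≤n     = halfPow≤1 b
  halfPow-anti (s≤s a≤b) = ≤-*ˡ 0≤½ (halfPow-anti a≤b)

  pow*halfPow : ∀ j → nq (2 ^ j) ℚ.* halfPow j ≡ 1ℚ
  pow*halfPow zero    = refl
  pow*halfPow (suc j) = begin
    nq (2 * 2 ^ j) ℚ.* (½ ℚ.* halfPow j)            ≡⟨ cong (ℚ._* (½ ℚ.* halfPow j)) (nq-* 2 (2 ^ j)) ⟩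
    (nq 2 ℚ.* nq (2 ^ j)) ℚ.* (½ ℚ.* halfPow j)     ≡⟨ interchange (nq 2) (nq (2 ^ j)) ½ (halfPow j) ⟩
    (nq 2 ℚ.* ½) ℚ.* (nq (2 ^ j) ℚ.* halfPow j)     ≡⟨ cong ((nq 2 ℚ.* ½) ℚ.*_) (pow*halfPow j) ⟩
    1ℚ ∎
    where
    open ≡-Reasoning

  scaled : ∀ {h d j} → h * 2 ^ d ≤ 2 ^ j → nq h ℚ.* halfPow j ℚ.≤ halfPow d
  scaled {h} {d} {j} le = begin
    nq h ℚ.* halfPow j                                    ≡⟨ ℚₚ.*-identityʳ _ ⟨
    nq h ℚ.* halfPow j ℚ.* 1ℚ                             ≡⟨ cong (nq h ℚ.* halfPow j ℚ.*_) (pow*halfPow d) ⟨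
    nq h ℚ.* halfPow j ℚ.* (nq (2 ^ d) ℚ.* halfPow d)     ≡⟨ interchange (nq h) (halfPow j) (nq (2 ^ d)) (halfPow d) ⟩
    nq h ℚ.* nq (2 ^ d) ℚ.* (halfPow j ℚ.* halfPow d)     ≡⟨ cong (ℚ._* (halfPow j ℚ.* halfPow d)) (nq-* h (2 ^ d)) ⟨
    nq (h * 2 ^ d) ℚ.* (halfPow j ℚ.* halfPow d)          ≤⟨ ≤-*ʳ (*-nonNeg (halfPow-nonNeg j) (halfPow-nonNeg d)) (nq-mono-≤ le) ⟩
    nq (2 ^ j) ℚ.* (halfPow j ℚ.* halfPow d)              ≡⟨ ℚₚ.*-assoc (nq (2 ^ j)) (halfPow j) (halfPow d) ⟨
    nq (2 ^ j) ℚ.* halfPow j ℚ.* halfPow d                ≡⟨ cong (ℚ._* halfPow d) (pow*halfPow j) ⟩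
    1ℚ ℚ.* halfPow d                                      ≡⟨ ℚₚ.*-identityˡ _ ⟩
    halfPow d ∎
    where
    open ℚₚ.≤-Reasoning

  sumFin-mono : ∀ {n} {f g : Fin n → ℚ} → (∀ i → f i ℚ.≤ g i) → sumFin n f ℚ.≤ sumFin n g
  sumFin-mono {zero}  f≤g = ℚₚ.≤-refl
  sumFin-mono {suc n} f≤g = ℚₚ.+-mono-≤ (f≤g zero) (sumFin-mono (f≤g ∘ suc))

  sumFin-nonNeg : ∀ {n} {f : Fin n → ℚ} → (∀ i → 0ℚ ℚ.≤ f i) → 0ℚ ℚ.≤ sumFin n f
  sumFin-nonNeg {zero}  0≤f = ℚₚ.≤-refl
  sumFin-nonNeg {suc n} 0≤f = ℚₚ.+-mono-≤ (0≤f zero) (sumFin-nonNeg (0≤f ∘ suc))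

  term≤sumFin : ∀ {n} {f : Fin n → ℚ} → (∀ i → 0ℚ ℚ.≤ f i) → ∀ i → f i ℚ.≤ sumFin n f
  term≤sumFin {suc n} {f} 0≤f zero    =
    ℚₚ.≤-trans (ℚₚ.≤-reflexive (≡-sym (ℚₚ.+-identityʳ (f zero)))) (ℚₚ.+-monoʳ-≤ (f zero) (sumFin-nonNeg (0≤f ∘ suc)))
  term≤sumFin {suc n} {f} 0≤f (suc i) =
    ℚₚ.≤-trans (term≤sumFin (0≤f ∘ suc) i)
    (ℚₚ.≤-trans (ℚₚ.≤-reflexive (≡-sym (ℚₚ.+-identityˡ _))) (ℚₚ.+-monoˡ-≤ _ (0≤f zero)))

  nq-sum : ∀ {n} (h : Fin n → ℕ) c → nq (sum h) ℚ.* c ≡ sumFin n (λ v → nq (h v) ℚ.* c)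
  nq-sum {zero}  h c = ℚₚ.*-zeroˡ c
  nq-sum {suc n} h c = trans (cong (ℚ._* c) (nq-+ (h zero) _))
    (trans (ℚₚ.*-distribʳ-+ c (nq (h zero)) _) (cong (nq (h zero) ℚ.* c ℚ.+_) (nq-sum (h ∘ suc) c)))

  weightTerm-nonNeg : ∀ d → 0ℚ ℚ.≤ weightTerm d
  weightTerm-nonNeg nothing        = ℚₚ.≤-refl
  weightTerm-nonNeg (just zero)    = 0≤nq 2
  weightTerm-nonNeg (just (suc k)) = halfPow-nonNeg k

  if-nonNeg : ∀ b {q} → 0ℚ ℚ.≤ q → 0ℚ ℚ.≤ (if b then q else 0ℚ)
  if-nonNeg true  0≤q = 0≤q
  if-nonNeg false 0≤q = ℚₚ.≤-refl

  module _ {n : ℕ} (G : Graph n) {g : ℕ} (girth : GirthAtLeast G g) where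

    module _ (f : Fin n → Bool) where

      private S = Vec.tabulate f

      -- An exhibited path bounds the distance only from above, which is the useful direction
      -- because weights decrease with the distance.
      dist-weight : ∀ {u v d w δ} → f u ≡ false → f v ≡ true → SPath G S u v (suc d) →
                    w ℚ.≤ halfPow d → IsDist G S u v δ → w ℚ.≤ weightTerm δ
      dist-weight {δ = nothing} fu fv path w≤ (_ , none) = ⊥-elim (none _ path)
      dist-weight {δ = just _}  fu fv path w≤ (inj₁ (refl , _)) with trans (≡-sym fu) fv
      ... | ()
      dist-weight {δ = just zero} fu fv path w≤ (inj₂ (u≢v , p , _)) =
        ⊥-elim (u≢v (trans (≡-sym (SPath.start p)) (SPath.end p)))
      dist-weight {δ = just (suc e)} fu fv path w≤ (inj₂ (_ , _ , min)) with min _ path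
      ... | s≤s e≤d = ℚₚ.≤-trans w≤ (halfPow-anti e≤d)

      manyHits→dominating : ∀ j → suc (suc j) + suc j ≤ g →
        (∀ u → f u ≡ false → 2 ^ j ≤ sum (λ v → firstHitsFrom G f v j u)) → ExpDominating G S
      manyHits→dominating j len hits u δ isDist with f u in fu
      ... | true  = ℚₚ.≤-trans self (term≤sumFin nonNeg u)
        where
        term : Fin n → ℚ
        term v = if Vec.lookup S v then weightTerm (δ v) else 0ℚ
        nonNeg : ∀ v → 0ℚ ℚ.≤ term v
        nonNeg v = if-nonNeg (Vec.lookup S v) (weightTerm-nonNeg (δ v))
        u∈S : u ∈S S
        u∈S = trans (lookup∘tabulate f u) fu
        self : 1ℚ ℚ.≤ term u
        self rewrite u∈S with δ u | isDist u u∈S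
        ... | nothing | u≢u , _               = ⊥-elim (u≢u refl)
        ... | just _  | inj₁ (_ , refl)       = ℚₚ.≤ᵇ⇒≤ _
        ... | just _  | inj₂ (u≢u , _)        = ⊥-elim (u≢u refl)
      ... | false = begin
        1ℚ                                                  ≡⟨ pow*halfPow j ⟨
        nq (2 ^ j) ℚ.* halfPow j                            ≤⟨ ≤-*ʳ (halfPow-nonNeg j) (nq-mono-≤ (hits u fu)) ⟩
        nq (sum (λ v → firstHitsFrom G f v j u)) ℚ.* halfPow j ≡⟨ nq-sum (λ v → firstHitsFrom G f v j u) (halfPow j) ⟩
        sumFin n (λ v → nq (firstHitsFrom G f v j u) ℚ.* halfPow j) ≤⟨ sumFin-mono bound ⟩
        weight S δ ∎
        where
        open ℚₚ.≤-Reasoning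
        bound : ∀ v → nq (firstHitsFrom G f v j u) ℚ.* halfPow j ℚ.≤ (if Vec.lookup S v then weightTerm (δ v) else 0ℚ)
        bound v with reachedFrom G {f} {v} girth j u len
        ... | inj₁ z rewrite z = ℚₚ.≤-trans (ℚₚ.≤-reflexive (ℚₚ.*-zeroˡ (halfPow j)))
                                            (if-nonNeg (Vec.lookup S v) (weightTerm-nonNeg (δ v)))
        ... | inj₂ (y , a , w , r , l , b) with route-f G r
        ...   | fv with trans (lookup∘tabulate f v) fv
        ...     | v∈S rewrite v∈S with route-start G r
        ...       | w′ , refl = dist-weight {δ = δ v} fu fv
                    (route-path G girth fu a r (≤-trans (s≤s l) (≤-trans (m≤m+n (suc (suc j)) (suc j)) len)))
                    -- A route on d + 1 vertices gives a path with d + 1 edges from `u`, of weight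
                    -- 2^(-d). Cancelling one factor 2 in `Reached` gives the matching bound 2^(j -
                    -- d) on the number of walks.
                    (scaled {firstHitsFrom G f v j u} {length w′} {j} (*-cancelˡ-≤ 2 (≤-trans (≤-reflexive (shift (firstHitsFrom G f v j u) (2 ^ length w′))) b)))
                    (isDist v v∈S)
          where
          shift : ∀ a b → 2 * (a * b) ≡ a * (2 * b)
          shift = solve-∀

  sumᴸ-allFin : ∀ {n} (h : Fin n → ℕ) → sumᴸ h (allFin n) ≡ sum h
  sumᴸ-allFin h = go h (λ i → i)
    where
    go : ∀ {n k} (h : Fin k → ℕ) (g : Fin n → Fin k) → sumᴸ h (List.tabulate g) ≡ sum (h ∘ g)
    go {zero}  h g = refl
    go {suc n} h g = cong (h (g zero) +_) (go h (g ∘ suc))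

  markov : ∀ {n} (h : Fin n → ℕ) k → card (λ u → k <ᵇ h u) * k ≤ sum h
  markov h k = ≤-trans (≤-reflexive (*-distribʳ-sum k (λ u → 𝟙 (k <ᵇ h u)))) (sum-mono pointwise)
    where
    pointwise : ∀ u → 𝟙 (k <ᵇ h u) * k ≤ h u
    pointwise u with k <ᵇ h u in eq
    ... | true  = ≤-trans (≤-reflexive (+-identityʳ k)) (<⇒≤ (<ᵇ⇒< k (h u) (subst T (≡-sym eq) tt)))
    ... | false = z≤n

  module _ {n : ℕ} (G : Graph (suc n)) (cubic : Cubic G) {g : ℕ} (girth : GirthAtLeast G g) where

    private
      N = suc n

    module _ (m s j : ℕ) (N≤ : N ≤ s * suc (suc j)) (len : suc (suc j) + suc j ≤ g) where

      private
        P = concatMap (walksFrom G j) (allFin N)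

        paths : All (Path {ℓ = suc (suc j)}) P
        paths = concatMap⁺ (All.universal
          (λ u → All.map (λ (r , l) → nb-unique G girth r (≤-trans (≤-reflexive l) (≤-trans (m≤m+n _ (suc j)) len)) , l)
                         (walksFrom-nb G j u)) (allFin N))

        avoiding-P : ∀ f → avoiding f P ≡ sum (λ u → avoiding f (walksFrom G j u))
        avoiding-P f = trans (sumᴸ-concatMap (misses f) (walksFrom G j) (allFin N)) (sumᴸ-allFin (λ u → avoiding f (walksFrom G j u)))

        total : avoiding (λ _ → false) P ≤ N * (3 * 2 ^ j)
        total = ≤-trans (≤-reflexive (avoiding-P _)) (≤-trans (sum-mono
          (λ u → ≤-trans (m≤n+m (avoiding _ (walksFrom G j u)) _) (≤-reflexive (hits+missesFrom G cubic (λ _ → false) j u refl))))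
          (≤-reflexive (sum-const N (3 * 2 ^ j))))
          where
          sum-const : ∀ n c → sum {n} (λ _ → c) ≡ n * c
          sum-const zero    c = refl
          sum-const (suc n) c = cong (c +_) (sum-const n c)

      small-dominating : ∃ λ S → ExpDominating G S × ∣ S ∣ * 2 ^ suc m ≤ m * s * 2 ^ suc m + 3 * N
      small-dominating with hitting-set paths s m N≤
      ... | f , card-f , few = Vec.tabulate f′ , manyHits→dominating G girth f′ j len hits , size
        where
        open ≤-Reasoning
        bad : Fin N → Bool
        -- The threshold is two thirds of the 3·2^j walks from `u`, so a vertex that does not exceed
        -- it keeps the 2^j met walks required for weight 1.
        bad u = 2 * 2 ^ j <ᵇ avoiding f (walksFrom G j u)
        f′ = f ∪ bad
        f⊆f′ : ∀ x → f x ≡ true → f′ x ≡ true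
        f⊆f′ x fx rewrite fx = refl
        good : ∀ u → f′ u ≡ false → avoiding f (walksFrom G j u) ≤ 2 * 2 ^ j
        good u f′u with f u
        good u ()  | true
        good u f′u | false = ≮⇒≥ (λ lt → subst T f′u (<⇒<ᵇ lt))
        hits : ∀ u → f′ u ≡ false → 2 ^ j ≤ sum (λ v → firstHitsFrom G f′ v j u)
        -- Adding the bad vertices moves first hits, so these are counted with respect to `f′`; only
        -- the number of missed walks is compared with that of `f`, and it cannot grow.
        hits u f′u = +-cancelʳ-≤ (2 * 2 ^ j) _ _ (begin
          3 * 2 ^ j                                   ≡⟨ hits+missesFrom G cubic f′ j u f′u ⟨
          H + avoiding f′ (walksFrom G j u)           ≤⟨ +-monoʳ-≤ H (avoiding-anti f⊆f′ (walksFrom G j u)) ⟩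
          H + avoiding f (walksFrom G j u)            ≤⟨ +-monoʳ-≤ H (good u f′u) ⟩
          H + 2 * 2 ^ j ∎)
          where H = sum (λ v → firstHitsFrom G f′ v j u)
        bad-few : card bad * 2 ^ suc m ≤ 3 * N
        bad-few = *-cancelʳ-≤ _ _ (2 ^ j) {{m^n≢0 2 j}} (begin
          card bad * 2 ^ suc m * 2 ^ j                ≡⟨ shuffle (card bad) (2 ^ m) (2 ^ j) ⟩
          2 ^ m * (card bad * (2 * 2 ^ j))            ≤⟨ *-monoʳ-≤ (2 ^ m) (markov (λ u → avoiding f (walksFrom G j u)) (2 * 2 ^ j)) ⟩
          2 ^ m * sum (λ u → avoiding f (walksFrom G j u)) ≡⟨ cong (2 ^ m *_) (avoiding-P f) ⟨
          2 ^ m * avoiding f P                        ≤⟨ few ⟩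
          avoiding (λ _ → false) P                    ≤⟨ total ⟩
          N * (3 * 2 ^ j)                             ≡⟨ shuffle′ N (2 ^ j) ⟩
          3 * N * 2 ^ j ∎)
          where
          shuffle : ∀ a b c → a * (2 * b) * c ≡ b * (a * (2 * c))
          shuffle = solve-∀
          shuffle′ : ∀ a b → a * (3 * b) ≡ 3 * a * b
          shuffle′ = solve-∀
        size : ∣ Vec.tabulate f′ ∣ * 2 ^ suc m ≤ m * s * 2 ^ suc m + 3 * N
        size = begin
          ∣ Vec.tabulate f′ ∣ * 2 ^ suc m             ≡⟨ cong (_* 2 ^ suc m) (card-tabulate f′) ⟩
          card f′ * 2 ^ suc m                         ≤⟨ *-monoˡ-≤ (2 ^ suc m) (card-∪ f bad) ⟩
          (card f + card bad) * 2 ^ suc m             ≡⟨ *-distribʳ-+ (2 ^ suc m) (card f) (card bad) ⟩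
          card f * 2 ^ suc m + card bad * 2 ^ suc m   ≤⟨ +-mono-≤ (*-monoˡ-≤ (2 ^ suc m) card-f) bad-few ⟩
          m * s * 2 ^ suc m + 3 * N ∎

    -- A non-backtracking walk on ℓ ≤ g vertices is injective, so ℓ ≤ N.
    walk-length≤order : ∀ j → suc (suc j) ≤ g → suc (suc j) ≤ N
    walk-length≤order j ℓ≤g = exists (walksFrom G j zero) (walksFrom-nb G j zero)
        (≤-trans (m≤m+n 1 _) (≤-trans (*-mono-≤ {1} {3} (s≤s z≤n) (m^n>0 2 j)) (≤-reflexive (≡-sym nonempty))))
      where
      -- The empty set misses every walk, so this value is the number of walks; its positivity
      -- provides one.
      nonempty : avoiding (λ _ → false) (walksFrom G j zero) ≡ 3 * 2 ^ j
      nonempty = trans (cong (_+ avoiding (λ _ → false) (walksFrom G j zero)) (≡-sym (none))) (hits+missesFrom G cubic (λ _ → false) j zero refl)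
        where
        none : sum (λ v → firstHitsFrom G (λ _ → false) v j zero) ≡ 0
        none = sum-zero (λ v → zeroᴸ v j zero (neighbours G zero))
          where
          zeroᴸ : ∀ v j c ys → sumᴸ (λ y → firstHits G (λ _ → false) v c y j) ys ≡ 0
          zeroᴸ v j       c []       = refl
          zeroᴸ v zero    c (y ∷ ys) = zeroᴸ v zero c ys
          zeroᴸ v (suc j) c (y ∷ ys) = cong₂ _+_ (zeroᴸ v j y (successors G c y)) (zeroᴸ v (suc j) c ys)
      exists : ∀ P → All (λ w → NonBacktracking G w × length w ≡ suc (suc j)) P →
               1 ≤ avoiding (λ _ → false) P → suc (suc j) ≤ N
      exists (w ∷ P) ((r , l) ∷ _) _ = ≤-trans (≤-reflexive (≡-sym l))
        (Finₚ.injective⇒≤ (λ {x} {y} → lookup-injective (nb-unique G girth r (≤-trans (≤-reflexive l) ℓ≤g)) x y))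

  -- With ℓ = m 2^m and s = 1 + ⌊n / ℓ⌋ the greedy vertices contribute m s 2^(m + 1) = 2 s ℓ ≤ 2 (n
  -- + ℓ) ≤ 4n, where `walk-length≤order` gives ℓ ≤ n; the bad vertices contribute 3n. Girth 2ℓ
  -- covers the 2ℓ - 1 vertices of two glued routes.
  domination-bound : ∀ {n} (G : Graph n) → Cubic G → ∀ m → 1 ≤ m → GirthAtLeast G (2 * (m * 2 ^ m)) →
                     ∀ k → IsExpDomNumber G k → k * 2 ^ suc m ≤ 7 * n
  domination-bound {zero} G cubic m 1≤m girth k (((S , _ , refl)) , _) with S
  ... | Vec.[] = z≤n
  domination-bound {suc n} G cubic m 1≤m girth k (_ , minimal) = go (m * 2 ^ m) refl ℓ≥2 girth
    where
    open ≤-Reasoning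
    ℓ≥2 : 2 ≤ m * 2 ^ m
    ℓ≥2 = *-mono-≤ 1≤m (^-monoʳ-≤ 2 1≤m)
    go : ∀ ℓ → m * 2 ^ m ≡ ℓ → 2 ≤ ℓ → GirthAtLeast G (2 * ℓ) → k * 2 ^ suc m ≤ 7 * suc n
    go ℓ@(suc (suc j)) ℓ≡ (s≤s (s≤s z≤n)) girth = conclude (small-dominating G cubic girth m s j N≤sℓ len)
      where
      N = suc n
      s = suc (N / ℓ)
      len : ℓ + suc j ≤ 2 * ℓ
      len = +-monoʳ-≤ ℓ (≤-trans (n≤1+n (suc j)) (≤-reflexive (≡-sym (+-identityʳ ℓ))))
      N≤sℓ : N ≤ s * ℓ
      N≤sℓ = ≤-trans (≤-reflexive (m≡m%n+[m/n]*n N ℓ)) (+-monoˡ-≤ _ (<⇒≤ (m%n<n N ℓ)))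
      ℓ≤N : ℓ ≤ N
      ℓ≤N = walk-length≤order G cubic girth j (m≤m+n ℓ _)
      conclude : (∃ λ S → ExpDominating G S × ∣ S ∣ * 2 ^ suc m ≤ m * s * 2 ^ suc m + 3 * N) → k * 2 ^ suc m ≤ 7 * N
      conclude (S , dom , size) = begin
        k * 2 ^ suc m                 ≤⟨ *-monoˡ-≤ (2 ^ suc m) (minimal S dom) ⟩
        ∣ S ∣ * 2 ^ suc m             ≤⟨ size ⟩
        m * s * 2 ^ suc m + 3 * N     ≡⟨ cong (_+ 3 * N) (shuffle m s (2 ^ m)) ⟩
        2 * (s * (m * 2 ^ m)) + 3 * N ≡⟨ cong (λ x → 2 * (s * x) + 3 * N) ℓ≡ ⟩
        2 * (ℓ + N / ℓ * ℓ) + 3 * N   ≤⟨ +-monoˡ-≤ (3 * N) (*-monoʳ-≤ 2 (+-mono-≤ ℓ≤N (m/n*n≤m N ℓ))) ⟩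
        2 * (N + N) + 3 * N           ≡⟨ collect N ⟩
        7 * N ∎
        where
        shuffle : ∀ a b c → a * b * (2 * c) ≡ 2 * (b * (a * c))
        shuffle = solve-∀
        collect : ∀ a → 2 * (a + a) + 3 * a ≡ 7 * a
        collect = solve-∀

-- Cubic bipartite graphs from three permutations

module BipartiteGraphs where

  open import Data.Nat using (ℕ; zero; suc; _<_; _+_; _≤?_; s≤s)
  open import Data.Nat.Properties
  open import Algebra.Properties.Semiring.Sum +-*-semiring using (sum; sum-cong-≗; ∑-distrib-+)
  open HittingSets
  open Walks using (card-tabulate)

  sum-split : ∀ a {b} (f : Fin (a + b) → ℕ) → sum f ≡ sum (λ i → f (i ↑ˡ b)) + sum (λ i → f (a ↑ʳ i))
  sum-split zero    f = refl
  sum-split (suc a) f = trans (cong (f zero +_) (sum-split a (f ∘ suc))) (≡-sym (+-assoc (f zero) _ _))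

  module BipartiteCubic {N : ℕ} (F F⁻¹ : Fin 3 → Fin N → Fin N)
    (F⁻¹∘F : ∀ i x → F⁻¹ i (F i x) ≡ x) (F∘F⁻¹ : ∀ i y → F i (F⁻¹ i y) ≡ y)
    (F-distinct : ∀ {i j} x → F i x ≡ F j x → i ≡ j) where

    Vertex : Set
    Vertex = Fin N ⊎ Fin N

    data Edge (i : Fin 3) : Vertex → Vertex → Set where
      up   : ∀ x → Edge i (inj₁ x) (inj₂ (F i x))
      down : ∀ x → Edge i (inj₂ (F i x)) (inj₁ x)

    edge-sym : ∀ {i u v} → Edge i u v → Edge i v u
    edge-sym (up x)   = down x
    edge-sym (down x) = up x

    F-injective : ∀ {i x y} → F i x ≡ F i y → x ≡ y
    F-injective {i} {x} {y} eq = trans (≡-sym (F⁻¹∘F i x)) (trans (cong (F⁻¹ i) eq) (F⁻¹∘F i y))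

    -- Every colour class is a matching. This is what turns distinct neighbours into distinct
    -- colours.
    edge-functional : ∀ {i u v w w′} → Edge i u v → Edge i w w′ → u ≡ w → v ≡ w′
    edge-functional (up x)   (up y)   refl = refl
    edge-functional (down x) (down y) eq   = cong inj₁ (F-injective (inj₂-injective eq))

    joined : Fin N → Fin N → Bool
    joined x y = δ[ F 0F x , y ] ∨ δ[ F 1F x , y ] ∨ δ[ F 2F x , y ]

    joined→edge : ∀ x y → joined x y ≡ true → ∃ λ i → F i x ≡ y
    joined→edge x y eq with F 0F x Fin.≟ y | F 1F x Fin.≟ y | F 2F x Fin.≟ y
    ... | yes e | _     | _     = 0F , e
    ... | no  _ | yes e | _     = 1F , e
    ... | no  _ | no  _ | yes e = 2F , e
    joined→edge x y () | no _ | no _ | no _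

    adjacent : Vertex → Vertex → Bool
    adjacent (inj₁ x) (inj₂ y) = joined x y
    adjacent (inj₂ y) (inj₁ x) = joined x y
    adjacent (inj₁ _) (inj₁ _) = false
    adjacent (inj₂ _) (inj₂ _) = false

    adjacent-sym : ∀ u v → adjacent u v ≡ adjacent v u
    adjacent-sym (inj₁ _) (inj₁ _) = refl
    adjacent-sym (inj₁ _) (inj₂ _) = refl
    adjacent-sym (inj₂ _) (inj₁ _) = refl
    adjacent-sym (inj₂ _) (inj₂ _) = refl

    adjacent-irrefl : ∀ u → adjacent u u ≡ false
    adjacent-irrefl (inj₁ _) = refl
    adjacent-irrefl (inj₂ _) = refl

    adjacent→edge : ∀ u v → adjacent u v ≡ true → ∃ λ i → Edge i u v
    adjacent→edge (inj₁ x) (inj₂ y) a with joined→edge x y a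
    ... | i , refl = i , up x
    adjacent→edge (inj₂ y) (inj₁ x) a with joined→edge x y a
    ... | i , refl = i , down x

    graph : Graph (N + N)
    graph = record
      { adj   = λ u v → adjacent (splitAt N u) (splitAt N v)
      ; sym   = λ u v → adjacent-sym (splitAt N u) (splitAt N v)
      ; irrfl = λ u → adjacent-irrefl (splitAt N u)
      }

    𝟙-∨ : ∀ a b c → (a ≡ true → b ≡ true → ⊥) → (a ≡ true → c ≡ true → ⊥) → (b ≡ true → c ≡ true → ⊥) →
          𝟙 (a ∨ b ∨ c) ≡ 𝟙 a + (𝟙 b + 𝟙 c)
    𝟙-∨ true  true  _     p q r = ⊥-elim (p refl refl)
    𝟙-∨ true  false true  p q r = ⊥-elim (q refl refl)
    𝟙-∨ true  false false p q r = refl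
    𝟙-∨ false true  true  p q r = ⊥-elim (r refl refl)
    𝟙-∨ false true  false p q r = refl
    𝟙-∨ false false _     p q r = refl

    δ→≡ : ∀ {n} {x y : Fin n} → δ[ x , y ] ≡ true → x ≡ y
    δ→≡ {x = x} {y} eq with x Fin.≟ y
    ... | yes e = e
    δ→≡ {x = x} {y} () | no _

    three : (a : Fin 3 → Fin N) → (∀ {i j} → a i ≡ a j → i ≡ j) →
            sum (λ y → 𝟙 (δ[ a 0F , y ] ∨ δ[ a 1F , y ] ∨ δ[ a 2F , y ])) ≡ 3
    three a inj = trans (sum-cong-≗ (λ y → 𝟙-∨ _ _ _ (clash y λ ()) (clash y λ ()) (clash y λ ())))
      (trans (∑-distrib-+ (λ y → 𝟙 δ[ a 0F , y ]) _)
        (cong₂ _+_ (sum-δ (a 0F) 1) (trans (∑-distrib-+ (λ y → 𝟙 δ[ a 1F , y ]) _)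
          (cong₂ _+_ (sum-δ (a 1F) 1) (sum-δ (a 2F) 1)))))
      where
      clash : ∀ {i j} y → i ≢ j → δ[ a i , y ] ≡ true → δ[ a j , y ] ≡ true → ⊥
      clash y i≢j p q = i≢j (inj (trans (δ→≡ p) (≡-sym (δ→≡ q))))

    δ-inverse : ∀ i x y → δ[ F i x , y ] ≡ δ[ F⁻¹ i y , x ]
    δ-inverse i x y with F i x Fin.≟ y | F⁻¹ i y Fin.≟ x
    ... | yes _    | yes _    = refl
    ... | no  _    | no  _    = refl
    ... | yes refl | no  ≢x   = contradiction (F⁻¹∘F i x) ≢x
    ... | no  ≢y   | yes refl = contradiction (F∘F⁻¹ i y) ≢y

    cubic : Cubic graph
    cubic u = trans (card-tabulate (adj graph u))
      (trans (sum-split N (λ v → 𝟙 (adj graph u v)))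
      (trans (cong₂ _+_ (sum-cong-≗ (λ i → cong (𝟙 ∘ adjacent (splitAt N u)) (Finₚ.splitAt-↑ˡ N i N)))
                        (sum-cong-≗ (λ i → cong (𝟙 ∘ adjacent (splitAt N u)) (Finₚ.splitAt-↑ʳ N N i))))
      (count (splitAt N u))))
      where
      count : ∀ u → sum (λ x → 𝟙 (adjacent u (inj₁ x))) + sum (λ y → 𝟙 (adjacent u (inj₂ y))) ≡ 3
      count (inj₁ x) = cong₂ _+_ (sum-zero {N} {λ _ → 0} (λ _ → refl)) (three (λ i → F i x) (F-distinct x))
      count (inj₂ y) = cong₂ _+_
        (trans (sum-cong-≗ (λ x → cong 𝟙 (cong₂ _∨_ (δ-inverse 0F x y) (cong₂ _∨_ (δ-inverse 1F x y) (δ-inverse 2F x y)))))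
               (three (λ i → F⁻¹ i y) inj))
        (sum-zero {N} {λ _ → 0} (λ _ → refl))
        where
        inj : ∀ {i j} → F⁻¹ i y ≡ F⁻¹ j y → i ≡ j
        inj {i} {j} eq = F-distinct (F⁻¹ i y) (trans (F∘F⁻¹ i y) (≡-sym (trans (cong (F j) eq) (F∘F⁻¹ j y))))

    -- A walk described by its edge colours: not reversing an edge means changing the colour. The
    -- first and the last colour are recorded because the condition at the closing vertex compares
    -- them.
    data Trail (u : Vertex) (i : Fin 3) : Vertex → Fin 3 → ℕ → Set where
      start  : ∀ {v} → Edge i u v → Trail u i v i 1
      extend : ∀ {v w j j′ k} → Trail u i v j k → Edge j′ v w → j ≢ j′ → Trail u i w j′ (suc k)

    cycle→trail : ∀ {m} → Cycle graph m → ∃ λ u → ∃ λ i → ∃ λ j → i ≢ j × Trail u i u j (suc m)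
    cycle→trail {suc (suc m)} C = at zero , i₀ , close-colour
      where
      open Cycle C
      at : Fin (suc (suc (suc m))) → Vertex
      at t = splitAt N (vtx t)
      at-inj : ∀ {s t} → at s ≡ at t → s ≡ t
      at-inj {s} {t} eq = inj s t (trans (≡-sym (Finₚ.join-splitAt N N (vtx s))) (trans (cong (Fin.join N N) eq) (Finₚ.join-splitAt N N (vtx t))))
      colour : ∀ t → ∃ λ i → Edge i (at (inject₁ t)) (at (suc t))
      colour t = adjacent→edge _ _ (step t)
      i₀ : Fin 3
      i₀ = proj₁ (colour zero)
      Along : Fin (suc (suc m)) → Set
      Along t = ∃ λ j → Edge j (at (inject₁ t)) (at (suc t)) × Trail (at zero) i₀ (at (suc t)) j (suc (toℕ t))
      along : ∀ t → Along t
      along = <-weakInduction Along (i₀ , proj₂ (colour zero) , start (proj₂ (colour zero))) next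
        where
        next : ∀ t → Along (inject₁ t) → Along (suc t)
        next t (j , e , trail) with colour (suc t)
        ... | j′ , e′ = j′ , e′ , subst (λ k → Trail (at zero) i₀ (at (suc (suc t))) j′ (suc (suc k))) (Finₚ.toℕ-inject₁ t)
                                        (extend trail e′ turn)
          where
          -- Equal colours would identify vertices two steps apart on the cycle.
          turn : j ≢ j′
          turn refl = <⇒≢ (≤-trans (s≤s (≤-reflexive (trans (Finₚ.toℕ-inject₁ (inject₁ t)) (Finₚ.toℕ-inject₁ t)))) (n≤1+n _))
                          (cong toℕ (at-inj (edge-functional (edge-sym e) e′ refl)))
      close-colour : ∃ λ j → i₀ ≢ j × Trail (at zero) i₀ (at zero) j (suc (suc (suc m)))
      close-colour with along (fromℕ (suc m)) | adjacent→edge _ _ close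
      ... | j , e , trail | j′ , e′ = j′ , first≢last ,
            subst (λ k → Trail (at zero) i₀ (at zero) j′ (suc (suc k))) (Finₚ.toℕ-fromℕ (suc m)) (extend trail e′ turn)
        where
        turn : j ≢ j′
        turn refl with at-inj (edge-functional (edge-sym e) e′ refl)
        ... | ()
        -- The first and the last edge meet at `at zero`; a common colour would identify its two
        -- neighbours on the cycle.
        first≢last : i₀ ≢ j′
        first≢last refl with at-inj (edge-functional (proj₂ (colour zero)) (edge-sym e′) refl)
        ... | ()
    cycle→trail {zero} C with Cycle.long C
    ... | s≤s ()
    cycle→trail {suc zero} C with Cycle.long C
    ... | s≤s (s≤s ())

    girth : ∀ g → (∀ {u i j k} → k < g → i ≢ j → Trail u i u j k → ⊥) → GirthAtLeast graph g
    girth g no-trail m C with g ≤? suc m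
    ... | yes g≤ = g≤
    ... | no  g≰ with cycle→trail C
    ...   | u , i , j , i≢j , trail = ⊥-elim (no-trail (≰⇒> g≰) i≢j trail)

-- Cubic graphs of logarithmic girth from integer matrices

module CongruenceGraphs where

  import Data.Nat as ℕ
  open ℕ using (ℕ; zero; suc; z≤n; s≤s; NonZero)
  import Data.Nat.Divisibility as ℕ∣
  open import Data.Nat.Primality using (prime?; euclidsLemma)
  import Data.Nat.Properties as ℕₚ
  open import Data.Nat.Tactic.RingSolver using () renaming (solve-∀ to solveℕ)
  open import Data.Integer using (ℤ; +_; -[1+_]; _+_; _*_; -_; _-_; 0ℤ; ∣_∣)
  open import Data.Integer.DivMod using (_%ℕ_; _/ℕ_; n%ℕd<d; a≡a%ℕn+[a/ℕn]*n)
  open import Data.Integer.Divisibility.Signed using (_∣_; divides; ∣⇒∣ᵤ; ∣ᵤ⇒∣; ∣m∣n⇒∣m+n; ∣m∣n⇒∣m-n; ∣m⇒∣-m; ∣n⇒∣m*n; ∣-trans)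
  import Data.Integer.Properties as ℤₚ
  open import Data.Integer.Tactic.RingSolver using (solve-∀)
  open BipartiteGraphs

  ^-distrib-* : ∀ a b k → (a ℕ.* b) ℕ.^ k ≡ a ℕ.^ k ℕ.* b ℕ.^ k
  ^-distrib-* a b zero    = refl
  ^-distrib-* a b (suc k) = trans (cong (a ℕ.* b ℕ.*_) (^-distrib-* a b k)) (ℕₚ.[m*n]*[o*p]≡[m*o]*[n*p] a b (a ℕ.^ k) (b ℕ.^ k))

  3ᴷ∣-cancel : ∀ K a b → ¬ 3 ℕ∣.∣ b → 3 ℕ.^ K ℕ∣.∣ a ℕ.* b → 3 ℕ.^ K ℕ∣.∣ a
  3ᴷ∣-cancel zero    a b ¬3∣b _ = ℕ∣.1∣ a
  3ᴷ∣-cancel (suc K) a b ¬3∣b d with euclidsLemma a b (from-yes (prime? 3)) (ℕ∣.∣-trans (ℕ∣.m∣m*n (3 ℕ.^ K)) d)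
  ... | inj₂ 3∣b = contradiction 3∣b ¬3∣b
  ... | inj₁ (ℕ∣.divides a′ refl) = subst (3 ℕ.^ suc K ℕ∣.∣_) (ℕₚ.*-comm 3 a′) (ℕ∣.*-monoʳ-∣ 3 (3ᴷ∣-cancel K a′ b ¬3∣b
        (ℕ∣.*-cancelˡ-∣ 3 (subst (3 ℕ.^ suc K ℕ∣.∣_) rearrange d))))
    where
    rearrange : a′ ℕ.* 3 ℕ.* b ≡ 3 ℕ.* (a′ ℕ.* b)
    rearrange = trans (cong (ℕ._* b) (ℕₚ.*-comm a′ 3)) (ℕₚ.*-assoc 3 a′ b)

  -- This is (3^K - 1) / 2; its successor is the inverse of 2 modulo 3^K.
  half3ᴷ : ℕ → ℕ
  half3ᴷ zero    = 0
  half3ᴷ (suc K) = 1 ℕ.+ 3 ℕ.* half3ᴷ K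

  3ᴷ-odd : ∀ K → + (3 ℕ.^ K) ≡ + 2 * (+ suc (half3ᴷ K)) - + 1
  3ᴷ-odd K = trans (cong +_ (odd K)) (trans (cong (λ z → + 1 + z) (ℤₚ.pos-* 2 (half3ᴷ K))) (regroup (+ half3ᴷ K)))
    where
    expand : ∀ h → 3 ℕ.* (1 ℕ.+ 2 ℕ.* h) ≡ 1 ℕ.+ 2 ℕ.* (1 ℕ.+ 3 ℕ.* h)
    expand = solveℕ
    odd : ∀ K → 3 ℕ.^ K ≡ 1 ℕ.+ 2 ℕ.* half3ᴷ K
    odd zero    = refl
    odd (suc K) = trans (cong (3 ℕ.*_) (odd K)) (expand (half3ᴷ K))
    regroup : ∀ x → + 1 + + 2 * x ≡ + 2 * (+ 1 + x) - + 1
    regroup = solve-∀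

  -- Parities of integers

  bit : Bool → ℤ
  bit true  = + 1
  bit false = + 0

  Parity : Bool → ℤ → Set
  Parity b a = ∃ λ k → a ≡ + 2 * k + bit b

  parity-+ : ∀ b c {x y} → Parity b x → Parity c y → Parity (b xor c) (x + y)
  parity-+ true  true  (k , refl) (l , refl) = k + l + + 1 , lemma k l
    where
    lemma : ∀ k l → (+ 2 * k + + 1) + (+ 2 * l + + 1) ≡ + 2 * (k + l + + 1) + + 0
    lemma = solve-∀
  parity-+ true  false (k , refl) (l , refl) = k + l , lemma k l
    where
    lemma : ∀ k l → (+ 2 * k + + 1) + (+ 2 * l + + 0) ≡ + 2 * (k + l) + + 1
    lemma = solve-∀
  parity-+ false true  (k , refl) (l , refl) = k + l , lemma k l
    where
    lemma : ∀ k l → (+ 2 * k + + 0) + (+ 2 * l + + 1) ≡ + 2 * (k + l) + + 1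
    lemma = solve-∀
  parity-+ false false (k , refl) (l , refl) = k + l , lemma k l
    where
    lemma : ∀ k l → (+ 2 * k + + 0) + (+ 2 * l + + 0) ≡ + 2 * (k + l) + + 0
    lemma = solve-∀

  parity-* : ∀ b c {x y} → Parity b x → Parity c y → Parity (b ∧ c) (x * y)
  parity-* true  true  (k , refl) (l , refl) = + 2 * k * l + k + l , lemma k l
    where
    lemma : ∀ k l → (+ 2 * k + + 1) * (+ 2 * l + + 1) ≡ + 2 * (+ 2 * k * l + k + l) + + 1
    lemma = solve-∀
  parity-* true  false (k , refl) (l , refl) = + 2 * k * l + l , lemma k l
    where
    lemma : ∀ k l → (+ 2 * k + + 1) * (+ 2 * l + + 0) ≡ + 2 * (+ 2 * k * l + l) + + 0
    lemma = solve-∀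
  parity-* false c {y = y} (k , refl) _ = k * y , lemma k y
    where
    lemma : ∀ k y → (+ 2 * k + + 0) * y ≡ + 2 * (k * y) + + 0
    lemma = solve-∀

  odd≢2* : ∀ {a b} → Parity true a → a ≢ + 2 * b
  odd≢2* {b = b} (k , refl) eq = ℕ∣.>⇒∤ (s≤s (s≤s z≤n)) (∣⇒∣ᵤ {+ 2} {+ 1} (divides (b - k) (lemma b k eq)))
    where
    lemma′ : ∀ k → + 1 ≡ (+ 2 * k + + 1) - + 2 * k
    lemma′ = solve-∀
    lemma″ : ∀ b k → + 2 * b - + 2 * k ≡ (b - k) * + 2
    lemma″ = solve-∀
    lemma : ∀ b k → + 2 * k + + 1 ≡ + 2 * b → + 1 ≡ (b - k) * + 2
    lemma b k eq = trans (lemma′ k) (trans (cong (_- + 2 * k) eq) (lemma″ b k))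

  -- The generators

  data Side : Set where
    point line : Side

  record Matrix : Set where
    constructor matrix
    field
      p q r s : ℤ

  _⊗_ : Matrix → Matrix → Matrix
  matrix p q r s ⊗ matrix a b c d = matrix (p * a + q * c) (p * b + q * d) (r * a + s * c) (r * b + s * d)

  det : Matrix → ℤ
  det (matrix p q r s) = p * s - q * r

  det-⊗ : ∀ P Q → det (P ⊗ Q) ≡ det P * det Q
  det-⊗ (matrix p q r s) (matrix a b c d) = lemma p q r s a b c d
    where
    lemma : ∀ p q r s a b c d →
      (p * a + q * c) * (r * b + s * d) - (p * b + q * d) * (r * a + s * c) ≡ (p * s - q * r) * (a * d - b * c)
    lemma = solve-∀

  adjugate : Matrix → Matrix
  adjugate (matrix p q r s) = matrix s (- q) (- r) p

  -- Modulo 2 these are κᵀκ for the three nonzero vectors κ of F₂². Modulo 3 each first column has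
  -- entries 1 and 0, which preserves the form (1 + 3u , y), and the remaining entries are chosen to
  -- separate the three images of a vector.
  generator : Fin 3 → Matrix
  generator 0F = matrix (+ 1) (+ 0) (+ 0) (+ 2)
  generator 1F = matrix -[1+ 1 ] (+ 0) (+ 0) -[1+ 0 ]
  generator 2F = matrix (+ 1) (+ 1) -[1+ 2 ] -[1+ 0 ]

  gen : Side → Fin 3 → Matrix
  gen point i = generator i
  gen line  i = adjugate (generator i)

  det-gen : ∀ σ i → det (gen σ i) ≡ + 2
  det-gen point 0F = refl
  det-gen point 1F = refl
  det-gen point 2F = refl
  det-gen line  0F = refl
  det-gen line  1F = refl
  det-gen line  2F = refl

  -- An entry of a product pairs a row of the left factor with a column of the right one, so column
  -- sums control the growth. The value 4 comes from the entries 1 and -3 of `generator 2F`.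
  gen-column₁ : ∀ σ i → ∣ Matrix.p (gen σ i) ∣ ℕ.+ ∣ Matrix.r (gen σ i) ∣ ℕ.≤ 4
  gen-column₁ point 0F = ℕₚ.≤ᵇ⇒≤ _ _ _
  gen-column₁ point 1F = ℕₚ.≤ᵇ⇒≤ _ _ _
  gen-column₁ point 2F = ℕₚ.≤ᵇ⇒≤ _ _ _
  gen-column₁ line  0F = ℕₚ.≤ᵇ⇒≤ _ _ _
  gen-column₁ line  1F = ℕₚ.≤ᵇ⇒≤ _ _ _
  gen-column₁ line  2F = ℕₚ.≤ᵇ⇒≤ _ _ _

  gen-column₂ : ∀ σ i → ∣ Matrix.q (gen σ i) ∣ ℕ.+ ∣ Matrix.s (gen σ i) ∣ ℕ.≤ 4
  gen-column₂ point 0F = ℕₚ.≤ᵇ⇒≤ _ _ _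
  gen-column₂ point 1F = ℕₚ.≤ᵇ⇒≤ _ _ _
  gen-column₂ point 2F = ℕₚ.≤ᵇ⇒≤ _ _ _
  gen-column₂ line  0F = ℕₚ.≤ᵇ⇒≤ _ _ _
  gen-column₂ line  1F = ℕₚ.≤ᵇ⇒≤ _ _ _
  gen-column₂ line  2F = ℕₚ.≤ᵇ⇒≤ _ _ _

  -- Stepping from σ to other σ scales row vectors by τ σ: a generator followed by its adjugate is twice the identity.
  τ : Side → ℤ
  τ point = + 1
  τ line  = + 2

  1≤τ : ∀ σ → 1 ℕ.≤ ∣ τ σ ∣
  1≤τ point = s≤s z≤n
  1≤τ line  = s≤s z≤n

  τ≤4 : ∀ σ → ∣ τ σ ∣ ℕ.≤ 4
  τ≤4 point = ℕₚ.≤ᵇ⇒≤ _ _ _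
  τ≤4 line  = ℕₚ.≤ᵇ⇒≤ _ _ _

  τ-cancel : ∀ σ {a b} → τ σ * a ≡ τ σ * b → a ≡ b
  τ-cancel point = ℤₚ.*-cancelˡ-≡ (+ 1) _ _
  τ-cancel line  = ℤₚ.*-cancelˡ-≡ (+ 2) _ _

  other : Side → Side
  other point = line
  other line  = point

  -- Modulo 2 every generator gen σ i is the rank one matrix κᵀκ with κ = column σ i.
  column : Side → Fin 3 → Bool × Bool
  column point 0F = true  , false
  column point 1F = false , true
  column point 2F = true  , true
  column line  0F = false , true
  column line  1F = true  , false
  column line  2F = true  , true

  κ₁ κ₂ : Side → Fin 3 → Bool
  κ₁ σ i = proj₁ (column σ i)
  κ₂ σ i = proj₂ (column σ i)

  HasParities : Bool → Bool → Bool → Bool → Matrix → Set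
  HasParities a b c d (matrix p q r s) = (Parity a p × Parity b q) × (Parity c r × Parity d s)

  gen-parity : ∀ σ i → HasParities (κ₁ σ i ∧ κ₁ σ i) (κ₁ σ i ∧ κ₂ σ i) (κ₂ σ i ∧ κ₁ σ i) (κ₂ σ i ∧ κ₂ σ i) (gen σ i)
  gen-parity point 0F = ((+ 0 , refl) , (+ 0 , refl)) , ((+ 0 , refl) , (+ 1 , refl))
  gen-parity point 1F = ((-[1+ 0 ] , refl) , (+ 0 , refl)) , ((+ 0 , refl) , (-[1+ 0 ] , refl))
  gen-parity point 2F = ((+ 0 , refl) , (+ 0 , refl)) , ((-[1+ 1 ] , refl) , (-[1+ 0 ] , refl))
  gen-parity line  0F = ((+ 1 , refl) , (+ 0 , refl)) , ((+ 0 , refl) , (+ 0 , refl))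
  gen-parity line  1F = ((-[1+ 0 ] , refl) , (+ 0 , refl)) , ((+ 0 , refl) , (-[1+ 0 ] , refl))
  gen-parity line  2F = ((-[1+ 0 ] , refl) , (-[1+ 0 ] , refl)) , ((+ 1 , refl) , (+ 0 , refl))

  -- A generator times its adjugate vanishes modulo 2, so `column (other σ) i` is orthogonal to
  -- `column σ i`. In F₂² only one nonzero vector is orthogonal to a given nonzero vector, hence all
  -- pairings of different indices equal 1.
  column-pairing : ∀ σ {i j} → i ≢ j →
    (κ₁ (other σ) i ∧ κ₁ σ j) xor (κ₂ (other σ) i ∧ κ₂ σ j) ≡ true
  column-pairing σ     {0F} {0F} i≢j = contradiction refl i≢j
  column-pairing σ     {1F} {1F} i≢j = contradiction refl i≢j
  column-pairing σ     {2F} {2F} i≢j = contradiction refl i≢j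
  column-pairing point {0F} {1F} _ = refl
  column-pairing point {0F} {2F} _ = refl
  column-pairing point {1F} {0F} _ = refl
  column-pairing point {1F} {2F} _ = refl
  column-pairing point {2F} {0F} _ = refl
  column-pairing point {2F} {1F} _ = refl
  column-pairing line  {0F} {1F} _ = refl
  column-pairing line  {0F} {2F} _ = refl
  column-pairing line  {1F} {0F} _ = refl
  column-pairing line  {1F} {2F} _ = refl
  column-pairing line  {2F} {0F} _ = refl
  column-pairing line  {2F} {1F} _ = refl

  -- One entry of the identity (cᵀρ)(kᵀz) = (ρ·k) cᵀz over F₂ with ρ·k = 1.
  outer-product-step : ∀ c ρ₁ ρ₂ k₁ k₂ z → (ρ₁ ∧ k₁) xor (ρ₂ ∧ k₂) ≡ true →
    ((c ∧ ρ₁) ∧ (k₁ ∧ z)) xor ((c ∧ ρ₂) ∧ (k₂ ∧ z)) ≡ c ∧ z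
  outer-product-step false _     _     _     _     _     _ = refl
  outer-product-step true  true  true  true  false z     _ = xor-identityʳ z
  outer-product-step true  true  true  false true  z     _ = refl
  outer-product-step true  true  false true  k₂    z     _ = xor-identityʳ z
  outer-product-step true  false true  k₁    true  z     _ = refl

  Bounded : ℕ → Matrix → Set
  Bounded B (matrix p q r s) = (∣ p ∣ ℕ.≤ B × ∣ q ∣ ℕ.≤ B) × (∣ r ∣ ℕ.≤ B × ∣ s ∣ ℕ.≤ B)

  bounded-gen : ∀ σ i → Bounded 4 (gen σ i)
  bounded-gen σ i =
    (ℕₚ.≤-trans (ℕₚ.m≤m+n _ _) (gen-column₁ σ i) , ℕₚ.≤-trans (ℕₚ.m≤m+n _ _) (gen-column₂ σ i)) ,
    (ℕₚ.≤-trans (ℕₚ.m≤n+m _ _) (gen-column₁ σ i) , ℕₚ.≤-trans (ℕₚ.m≤n+m _ _) (gen-column₂ σ i))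

  combination-bound : ∀ {B} p q {a c} → ∣ p ∣ ℕ.≤ B → ∣ q ∣ ℕ.≤ B → ∣ a ∣ ℕ.+ ∣ c ∣ ℕ.≤ 4 →
                      ∣ p * a + q * c ∣ ℕ.≤ 4 ℕ.* B
  combination-bound {B} p q {a} {c} p≤ q≤ ac≤ = begin
    ∣ p * a + q * c ∣                    ≤⟨ ℤₚ.∣i+j∣≤∣i∣+∣j∣ (p * a) (q * c) ⟩
    ∣ p * a ∣ ℕ.+ ∣ q * c ∣              ≡⟨ cong₂ ℕ._+_ (ℤₚ.abs-* p a) (ℤₚ.abs-* q c) ⟩
    ∣ p ∣ ℕ.* ∣ a ∣ ℕ.+ ∣ q ∣ ℕ.* ∣ c ∣  ≤⟨ ℕₚ.+-mono-≤ (ℕₚ.*-monoˡ-≤ ∣ a ∣ p≤) (ℕₚ.*-monoˡ-≤ ∣ c ∣ q≤) ⟩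
    B ℕ.* ∣ a ∣ ℕ.+ B ℕ.* ∣ c ∣          ≡⟨ ℕₚ.*-distribˡ-+ B ∣ a ∣ ∣ c ∣ ⟨
    B ℕ.* (∣ a ∣ ℕ.+ ∣ c ∣)              ≤⟨ ℕₚ.*-monoʳ-≤ B ac≤ ⟩
    B ℕ.* 4                              ≡⟨ ℕₚ.*-comm B 4 ⟩
    4 ℕ.* B ∎
    where open ℕₚ.≤-Reasoning

  bounded-⊗ : ∀ {B} P → Bounded B P → ∀ σ i → Bounded (4 ℕ.* B) (P ⊗ gen σ i)
  bounded-⊗ (matrix p q r s) ((p≤ , q≤) , (r≤ , s≤)) σ i =
    (combination-bound p q p≤ q≤ (gen-column₁ σ i) , combination-bound p q p≤ q≤ (gen-column₂ σ i)) ,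
    (combination-bound r s r≤ s≤ (gen-column₁ σ i) , combination-bound r s r≤ s≤ (gen-column₂ σ i))

  parity-⊗ : ∀ c₁ c₂ ρ₁ ρ₂ k₁ k₂ → (ρ₁ ∧ k₁) xor (ρ₂ ∧ k₂) ≡ true → ∀ P Q →
    HasParities (c₁ ∧ ρ₁) (c₁ ∧ ρ₂) (c₂ ∧ ρ₁) (c₂ ∧ ρ₂) P →
    HasParities (k₁ ∧ k₁) (k₁ ∧ k₂) (k₂ ∧ k₁) (k₂ ∧ k₂) Q →
    HasParities (c₁ ∧ k₁) (c₁ ∧ k₂) (c₂ ∧ k₁) (c₂ ∧ k₂) (P ⊗ Q)
  parity-⊗ c₁ c₂ ρ₁ ρ₂ k₁ k₂ pairing (matrix p q r s) (matrix a b c d) ((pp , pq) , (pr , ps)) ((pa , pb) , (pc , pd)) =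
    (entry c₁ k₁ pp pa pq pc , entry c₁ k₂ pp pb pq pd) , (entry c₂ k₁ pr pa ps pc , entry c₂ k₂ pr pb ps pd)
    where
    entry : ∀ c z {x y a c′} → Parity (c ∧ ρ₁) x → Parity (k₁ ∧ z) a → Parity (c ∧ ρ₂) y → Parity (k₂ ∧ z) c′ →
            Parity (c ∧ z) (x * a + y * c′)
    entry c z {x} {y} {a} {c′} px pa py pc = subst (λ b → Parity b (x * a + y * c′)) (outer-product-step c ρ₁ ρ₂ k₁ k₂ z pairing)
      (parity-+ _ _ (parity-* _ _ px pa) (parity-* _ _ py pc))

  -- Arithmetic modulo 3ᴷ

  module Residues (K : ℕ) (h : ℤ) (M≡2h-1 : + (3 ℕ.^ K) ≡ + 2 * h - + 1) where

    M : ℕ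
    M = 3 ℕ.^ K

    instance
      M≢0 : NonZero M
      M≢0 = ℕₚ.m^n≢0 3 K

    infix 4 _≈_
    record _≈_ (a b : ℤ) : Set where
      constructor congruent
      field difference : + M ∣ a - b
    open _≈_

    ∣-subst : ∀ {a b} → a ≡ b → + M ∣ a → + M ∣ b
    ∣-subst = subst (+ M ∣_)

    ≈-refl : ∀ {a} → a ≈ a
    ≈-refl {a} = congruent (divides (+ 0) (ℤₚ.+-inverseʳ a))

    ≈-reflexive : ∀ {a b} → a ≡ b → a ≈ b
    ≈-reflexive refl = ≈-refl

    ≈-sym : ∀ {a b} → a ≈ b → b ≈ a
    ≈-sym {a} {b} (congruent d) = congruent (∣-subst (lemma a b) (∣m⇒∣-m d))
      where
      lemma : ∀ a b → - (a - b) ≡ b - a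
      lemma = solve-∀

    ≈-trans : ∀ {a b c} → a ≈ b → b ≈ c → a ≈ c
    ≈-trans {a} {b} {c} (congruent d) (congruent e) = congruent (∣-subst (lemma a b c) (∣m∣n⇒∣m+n d e))
      where
      lemma : ∀ a b c → (a - b) + (b - c) ≡ a - c
      lemma = solve-∀

    mult≈ : ∀ {a b} k → a - b ≡ k * (+ 2 * h - + 1) → a ≈ b
    mult≈ k eq = congruent (divides k (trans eq (cong (k *_) (≡-sym M≡2h-1))))

    lift : Fin M → ℤ
    lift x = + toℕ x

    red : ℤ → Fin M
    red a = fromℕ< (n%ℕd<d a M)

    lift-red : ∀ a → lift (red a) ≈ a
    lift-red a = congruent (divides (- (a /ℕ M)) (trans (cong (λ z → + z - a) (Finₚ.toℕ-fromℕ< (n%ℕd<d a M)))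
      (trans (cong (λ z → + (a %ℕ M) - z) (a≡a%ℕn+[a/ℕn]*n a M)) (lemma (+ (a %ℕ M)) (a /ℕ M) (+ M)))))
      where
      lemma : ∀ r q m → r - (r + q * m) ≡ (- q) * m
      lemma = solve-∀

    small-multiple : ∀ {a} → + M ∣ a → ∣ a ∣ ℕ.< M → a ≡ 0ℤ
    small-multiple {a} d lt with ∣ a ∣ in eq
    ... | zero  = ℤₚ.∣i∣≡0⇒i≡0 eq
    ... | suc k = contradiction (subst (M ℕ∣.∣_) eq (∣⇒∣ᵤ d)) (ℕ∣.>⇒∤ lt)

    lift-injective : ∀ {x y} → lift x ≈ lift y → x ≡ y
    lift-injective {x} {y} (congruent d) = Finₚ.toℕ-injective (ℤₚ.+-injective (ℤₚ.i-j≡0⇒i≡j (lift x) (lift y) (small-multiple d bound)))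
      where
      bound : ∣ lift x - lift y ∣ ℕ.< M
      bound = ℕₚ.≤-<-trans (ℕₚ.≤-trans (ℕₚ.≤-reflexive (cong ∣_∣ (ℤₚ.m-n≡m⊖n (toℕ x) (toℕ y)))) (ℤₚ.∣m⊝n∣≤m⊔n (toℕ x) (toℕ y)))
                           (ℕₚ.⊔-lub (Finₚ.toℕ<n x) (Finₚ.toℕ<n y))

    -- The linear action on (1 + 3u , y) is affine in (u , y). With the coefficients as data, the
    -- inverse identities for the three maps become closed integer computations.
    record Affine : Set where
      constructor affine
      field
        α β γ : ℤ

    ev : Affine → ℤ → ℤ → ℤ
    ev (affine α β γ) u y = α * u + β * y + γ

    ev-cong : ∀ A {u u′ y y′} → u ≈ u′ → y ≈ y′ → ev A u y ≈ ev A u′ y′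
    ev-cong (affine α β γ) {u} {u′} {y} {y′} (congruent d) (congruent e) =
      congruent (∣-subst (lemma α β γ u u′ y y′) (∣m∣n⇒∣m+n (∣n⇒∣m*n α d) (∣n⇒∣m*n β e)))
      where
      lemma : ∀ α β γ u u′ y y′ → α * (u - u′) + β * (y - y′) ≡ (α * u + β * y + γ) - (α * u′ + β * y′ + γ)
      lemma = solve-∀

    *-cong-≈ : ∀ k {a b} → a ≈ b → k * a ≈ k * b
    *-cong-≈ k {a} {b} (congruent d) = congruent (∣-subst (lemma k a b) (∣n⇒∣m*n k d))
      where
      lemma : ∀ k a b → k * (a - b) ≡ k * a - k * b
      lemma = solve-∀

    compose : Affine → Affine → Affine → Affine
    compose (affine α β γ) (affine a b c) (affine a′ b′ c′) =
      affine (α * a + β * a′) (α * b + β * b′) (α * c + β * c′ + γ)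

    linear : Affine → Affine
    linear (affine α β γ) = affine α β (+ 0)

    ev-compose : ∀ A B C u y → ev A (ev B u y) (ev C u y) ≡ ev (compose A B C) u y
    ev-compose (affine α β γ) (affine a b c) (affine a′ b′ c′) u y = lemma α β γ a b c a′ b′ c′ u y
      where
      lemma : ∀ α β γ a b c a′ b′ c′ u y →
        α * (a * u + b * y + c) + β * (a′ * u + b′ * y + c′) + γ ≡
        (α * a + β * a′) * u + (α * b + β * b′) * y + (α * c + β * c′ + γ)
      lemma = solve-∀

    ev-scale : ∀ A h u y → ev A (h * u) (h * y) ≡ h * ev (linear A) u y + Affine.γ A
    ev-scale (affine α β γ) h u y = lemma α β γ h u y
      where
      lemma : ∀ α β γ h u y → α * (h * u) + β * (h * y) + γ ≡ h * (α * u + β * y + + 0) + γ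
      lemma = solve-∀

    Point : Set
    Point = Fin (M ℕ.* M)

    U Y : Point → ℤ
    U x = lift (proj₁ (remQuot {M} M x))
    Y x = lift (proj₂ (remQuot {M} M x))

    mk : ℤ → ℤ → Point
    mk u y = combine (red u) (red y)

    U-mk : ∀ u y → U (mk u y) ≈ u
    U-mk u y = ≈-trans (≈-reflexive (cong (lift ∘ proj₁) (Finₚ.remQuot-combine (red u) (red y)))) (lift-red u)

    Y-mk : ∀ u y → Y (mk u y) ≈ y
    Y-mk u y = ≈-trans (≈-reflexive (cong (lift ∘ proj₂) (Finₚ.remQuot-combine (red u) (red y)))) (lift-red y)

    point-ext : ∀ {x x′} → U x ≈ U x′ → Y x ≈ Y x′ → x ≡ x′
    point-ext {x} {x′} d e = trans (≡-sym (Finₚ.combine-remQuot {M} M x))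
      (trans (cong₂ combine (lift-injective d) (lift-injective e)) (Finₚ.combine-remQuot {M} M x′))

    -- (fu , fy) is the action of gen point i on the row vectors (1 + 3u , y), in the coordinates u, y;
    -- as h = 1/2 modulo M, its inverse is (h gu , h gy).
    fu fy gu gy : Fin 3 → Affine
    fu 0F = affine (+ 1) (+ 0) (+ 0)
    fu 1F = affine -[1+ 1 ] (+ 0) -[1+ 0 ]
    fu 2F = affine (+ 1) -[1+ 0 ] (+ 0)
    fy 0F = affine (+ 0) (+ 2) (+ 0)
    fy 1F = affine (+ 0) -[1+ 0 ] (+ 0)
    fy 2F = affine (+ 3) -[1+ 0 ] (+ 1)
    gu 0F = affine (+ 2) (+ 0) (+ 0)
    gu 1F = affine -[1+ 0 ] (+ 0) -[1+ 0 ]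
    gu 2F = affine -[1+ 0 ] (+ 1) -[1+ 0 ]
    gy 0F = affine (+ 0) (+ 1) (+ 0)
    gy 1F = affine (+ 0) -[1+ 1 ] (+ 0)
    gy 2F = affine -[1+ 2 ] (+ 1) -[1+ 0 ]

    F F⁻¹ : Fin 3 → Point → Point
    F   i x = mk (ev (fu i) (U x) (Y x)) (ev (fy i) (U x) (Y x))
    F⁻¹ i x = mk (h * ev (gu i) (U x) (Y x)) (h * ev (gy i) (U x) (Y x))

    U-F : ∀ i x → U (F i x) ≈ ev (fu i) (U x) (Y x)
    U-F i x = U-mk (ev (fu i) (U x) (Y x)) (ev (fy i) (U x) (Y x))

    Y-F : ∀ i x → Y (F i x) ≈ ev (fy i) (U x) (Y x)
    Y-F i x = Y-mk (ev (fu i) (U x) (Y x)) (ev (fy i) (U x) (Y x))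

    U-F⁻¹ : ∀ i x → U (F⁻¹ i x) ≈ h * ev (gu i) (U x) (Y x)
    U-F⁻¹ i x = U-mk (h * ev (gu i) (U x) (Y x)) (h * ev (gy i) (U x) (Y x))

    Y-F⁻¹ : ∀ i x → Y (F⁻¹ i x) ≈ h * ev (gy i) (U x) (Y x)
    Y-F⁻¹ i x = Y-mk (h * ev (gu i) (U x) (Y x)) (h * ev (gy i) (U x) (Y x))

    gu∘f : ∀ i → compose (gu i) (fu i) (fy i) ≡ affine (+ 2) (+ 0) (+ 0)
    gu∘f 0F = refl
    gu∘f 1F = refl
    gu∘f 2F = refl

    gy∘f : ∀ i → compose (gy i) (fu i) (fy i) ≡ affine (+ 0) (+ 2) (+ 0)
    gy∘f 0F = refl
    gy∘f 1F = refl
    gy∘f 2F = refl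

    -- As (gu , gy) is twice the inverse map, the linear part alone returns 2u minus twice the
    -- constant term; scaling by h and adding the constant term once gives back u.
    fu∘g : ∀ i → compose (linear (fu i)) (gu i) (gy i) ≡ affine (+ 2) (+ 0) (-[1+ 1 ] * Affine.γ (fu i))
    fu∘g 0F = refl
    fu∘g 1F = refl
    fu∘g 2F = refl

    fy∘g : ∀ i → compose (linear (fy i)) (gu i) (gy i) ≡ affine (+ 0) (+ 2) (-[1+ 1 ] * Affine.γ (fy i))
    fy∘g 0F = refl
    fy∘g 1F = refl
    fy∘g 2F = refl

    F⁻¹∘F : ∀ i x → F⁻¹ i (F i x) ≡ x
    F⁻¹∘F i x = point-ext
      (≈-trans (U-F⁻¹ i (F i x)) (≈-trans (*-cong-≈ h (ev-cong (gu i) (U-F i x) (Y-F i x)))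
        (≈-trans (≈-reflexive (cong (h *_) (trans (ev-compose (gu i) (fu i) (fy i) (U x) (Y x)) (cong (λ A → ev A (U x) (Y x)) (gu∘f i)))))
                 (mult≈ (U x) (lemma₁ h (U x) (Y x))))))
      (≈-trans (Y-F⁻¹ i (F i x)) (≈-trans (*-cong-≈ h (ev-cong (gy i) (U-F i x) (Y-F i x)))
        (≈-trans (≈-reflexive (cong (h *_) (trans (ev-compose (gy i) (fu i) (fy i) (U x) (Y x)) (cong (λ A → ev A (U x) (Y x)) (gy∘f i)))))
                 (mult≈ (Y x) (lemma₂ h (U x) (Y x))))))
      where
      lemma₁ : ∀ h u y → h * (+ 2 * u + + 0 * y + + 0) - u ≡ u * (+ 2 * h - + 1)
      lemma₁ = solve-∀
      lemma₂ : ∀ h u y → h * (+ 0 * u + + 2 * y + + 0) - y ≡ y * (+ 2 * h - + 1)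
      lemma₂ = solve-∀

    F∘F⁻¹ : ∀ i x → F i (F⁻¹ i x) ≡ x
    F∘F⁻¹ i x = point-ext
      (≈-trans (U-F i (F⁻¹ i x)) (≈-trans (ev-cong (fu i) (U-F⁻¹ i x) (Y-F⁻¹ i x))
        (≈-trans (≈-reflexive (trans (ev-scale (fu i) h (ev (gu i) (U x) (Y x)) (ev (gy i) (U x) (Y x))) (cong (λ z → h * z + c)
                   (trans (ev-compose (linear (fu i)) (gu i) (gy i) (U x) (Y x)) (cong (λ A → ev A (U x) (Y x)) (fu∘g i))))))
                 (mult≈ (U x - c) (lemma₁ h (U x) (Y x) c)))))
      (≈-trans (Y-F i (F⁻¹ i x)) (≈-trans (ev-cong (fy i) (U-F⁻¹ i x) (Y-F⁻¹ i x))
        (≈-trans (≈-reflexive (trans (ev-scale (fy i) h (ev (gu i) (U x) (Y x)) (ev (gy i) (U x) (Y x))) (cong (λ z → h * z + d)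
                   (trans (ev-compose (linear (fy i)) (gu i) (gy i) (U x) (Y x)) (cong (λ A → ev A (U x) (Y x)) (fy∘g i))))))
                 (mult≈ (Y x - d) (lemma₂ h (U x) (Y x) d)))))
      where
      c d : ℤ
      c = Affine.γ (fu i)
      d = Affine.γ (fy i)
      lemma₁ : ∀ h u y c → h * (+ 2 * u + + 0 * y + -[1+ 1 ] * c) + c - u ≡ (u - c) * (+ 2 * h - + 1)
      lemma₁ = solve-∀
      lemma₂ : ∀ h u y c → h * (+ 0 * u + + 2 * y + -[1+ 1 ] * c) + c - y ≡ (y - c) * (+ 2 * h - + 1)
      lemma₂ = solve-∀

    F-≡→ev-≈ : ∀ i j x → F i x ≡ F j x →
      ev (fu i) (U x) (Y x) ≈ ev (fu j) (U x) (Y x) × ev (fy i) (U x) (Y x) ≈ ev (fy j) (U x) (Y x)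
    F-≡→ev-≈ i j x eq =
      ≈-trans (≈-sym (U-F i x)) (≈-trans (≈-reflexive (cong U eq)) (U-F j x)) ,
      ≈-trans (≈-sym (Y-F i x)) (≈-trans (≈-reflexive (cong Y eq)) (Y-F j x))

    module _ (3∣M : + 3 ∣ + M) where

      -- For any two of the three maps, one coordinate of the images of a point differs by 1 modulo
      -- 3; this tells the neighbours of a vertex apart.
      1-mod-3 : ∀ {a b} w → a - b ≡ + 3 * w + + 1 → ¬ a ≈ b
      1-mod-3 {a} {b} w eq (congruent d) = ℕ∣.>⇒∤ {m = 3} (s≤s (s≤s z≤n)) (∣⇒∣ᵤ {+ 3} {+ 1}
        (subst (+ 3 ∣_) (lemma w) (∣m∣n⇒∣m-n (subst (+ 3 ∣_) eq (∣-trans 3∣M d)) (divides w (ℤₚ.*-comm (+ 3) w)))))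
        where
        lemma : ∀ w → (+ 3 * w + + 1) - + 3 * w ≡ + 1
        lemma = solve-∀

      F₀≢F₁ : ∀ x → F 0F x ≢ F 1F x
      F₀≢F₁ x eq = 1-mod-3 (U x) (lemma (U x) (Y x)) (proj₁ (F-≡→ev-≈ 0F 1F x eq))
        where
        lemma : ∀ u y → (+ 1 * u + + 0 * y + + 0) - (-[1+ 1 ] * u + + 0 * y + -[1+ 0 ]) ≡ + 3 * u + + 1
        lemma = solve-∀

      F₂≢F₀ : ∀ x → F 2F x ≢ F 0F x
      F₂≢F₀ x eq = 1-mod-3 (U x - Y x) (lemma (U x) (Y x)) (proj₂ (F-≡→ev-≈ 2F 0F x eq))
        where
        lemma : ∀ u y → (+ 3 * u + -[1+ 0 ] * y + + 1) - (+ 0 * u + + 2 * y + + 0) ≡ + 3 * (u - y) + + 1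
        lemma = solve-∀

      F₂≢F₁ : ∀ x → F 2F x ≢ F 1F x
      F₂≢F₁ x eq = 1-mod-3 (U x) (lemma (U x) (Y x)) (proj₂ (F-≡→ev-≈ 2F 1F x eq))
        where
        lemma : ∀ u y → (+ 3 * u + -[1+ 0 ] * y + + 1) - (+ 0 * u + -[1+ 0 ] * y + + 0) ≡ + 3 * u + + 1
        lemma = solve-∀

      F-distinct : ∀ {i j} x → F i x ≡ F j x → i ≡ j
      F-distinct {0F} {0F} x eq = refl
      F-distinct {1F} {1F} x eq = refl
      F-distinct {2F} {2F} x eq = refl
      F-distinct {0F} {1F} x eq = ⊥-elim (F₀≢F₁ x eq)
      F-distinct {1F} {0F} x eq = ⊥-elim (F₀≢F₁ x (≡-sym eq))
      F-distinct {2F} {0F} x eq = ⊥-elim (F₂≢F₀ x eq)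
      F-distinct {0F} {2F} x eq = ⊥-elim (F₂≢F₀ x (≡-sym eq))
      F-distinct {2F} {1F} x eq = ⊥-elim (F₂≢F₁ x eq)
      F-distinct {1F} {2F} x eq = ⊥-elim (F₂≢F₁ x (≡-sym eq))

      open BipartiteCubic F F⁻¹ F⁻¹∘F F∘F⁻¹ F-distinct

      side : Vertex → Side
      side (inj₁ _) = point
      side (inj₂ _) = line

      base : Vertex → Point
      base (inj₁ x) = x
      base (inj₂ y) = y

      -- Each vertex carries the row vector (V₁ , V₂); 3 ∤ V₁ makes it unimodular modulo M.
      V₁ V₂ : Vertex → ℤ
      V₁ v = + 3 * U (base v) + + 1
      V₂ v = Y (base v)

      side-edge : ∀ {i u v} → Edge i u v → side u ≡ other (side v)
      side-edge (up _)   = refl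
      side-edge (down _) = refl

      τ-edge : ∀ {i u v} → Edge i u v → τ (side v) * τ (side u) ≡ + 2
      τ-edge (up _)   = refl
      τ-edge (down _) = refl

      combination-cong : ∀ {a a′ b b′} m n → a ≈ a′ → b ≈ b′ → a * m + b * n ≈ a′ * m + b′ * n
      combination-cong {a} {a′} {b} {b′} m n (congruent d) (congruent e) =
        congruent (∣-subst (lemma a a′ b b′ m n) (∣m∣n⇒∣m+n (∣n⇒∣m*n m d) (∣n⇒∣m*n n e)))
        where
        lemma : ∀ a a′ b b′ m n → m * (a - a′) + n * (b - b′) ≡ (a * m + b * n) - (a′ * m + b′ * n)
        lemma = solve-∀

      +-cong-≈ : ∀ c {a b} → a ≈ b → a + c ≈ b + c
      +-cong-≈ c {a} {b} (congruent d) = congruent (∣-subst (lemma a b c) d)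
        where
        lemma : ∀ a b c → a - b ≡ (a + c) - (b + c)
        lemma = solve-∀

      _·_ : ℤ × ℤ → Matrix → ℤ × ℤ
      (x , y) · matrix p q r s = x * p + y * r , x * q + y * s

      record _≋_ (x y : ℤ × ℤ) : Set where
        constructor componentwise
        field
          first≈  : proj₁ x ≈ proj₁ y
          second≈ : proj₂ x ≈ proj₂ y

      ≋-reflexive : ∀ {x y} → x ≡ y → x ≋ y
      ≋-reflexive refl = componentwise ≈-refl ≈-refl

      ≋-sym : ∀ {x y} → x ≋ y → y ≋ x
      ≋-sym (componentwise d e) = componentwise (≈-sym d) (≈-sym e)

      ≋-trans : ∀ {x y z} → x ≋ y → y ≋ z → x ≋ z
      ≋-trans (componentwise d e) (componentwise d′ e′) = componentwise (≈-trans d d′) (≈-trans e e′)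

      ·-cong : ∀ {x y} N → x ≋ y → (x · N) ≋ (y · N)
      ·-cong (matrix p q r s) (componentwise d e) = componentwise (combination-cong p r d e) (combination-cong q s d e)

      vec : Vertex → ℤ × ℤ
      vec v = V₁ v , V₂ v

      _•_ : ℤ → ℤ × ℤ → ℤ × ℤ
      t • (x , y) = t * x , t * y

      gen-ev₁ : ∀ i u y → + 3 * ev (fu i) u y + + 1 ≡ proj₁ ((+ 3 * u + + 1 , y) · gen point i)
      gen-ev₁ 0F = lemma
        where
        lemma : ∀ u y → + 3 * (+ 1 * u + + 0 * y + + 0) + + 1 ≡ (+ 3 * u + + 1) * + 1 + y * + 0
        lemma = solve-∀
      gen-ev₁ 1F = lemma
        where
        lemma : ∀ u y → + 3 * (-[1+ 1 ] * u + + 0 * y + -[1+ 0 ]) + + 1 ≡ (+ 3 * u + + 1) * -[1+ 1 ] + y * + 0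
        lemma = solve-∀
      gen-ev₁ 2F = lemma
        where
        lemma : ∀ u y → + 3 * (+ 1 * u + -[1+ 0 ] * y + + 0) + + 1 ≡ (+ 3 * u + + 1) * + 1 + y * -[1+ 2 ]
        lemma = solve-∀

      gen-ev₂ : ∀ i u y → ev (fy i) u y ≡ proj₂ ((+ 3 * u + + 1 , y) · gen point i)
      gen-ev₂ 0F = lemma
        where
        lemma : ∀ u y → + 0 * u + + 2 * y + + 0 ≡ (+ 3 * u + + 1) * + 0 + y * + 2
        lemma = solve-∀
      gen-ev₂ 1F = lemma
        where
        lemma : ∀ u y → + 0 * u + -[1+ 0 ] * y + + 0 ≡ (+ 3 * u + + 1) * + 0 + y * -[1+ 0 ]
        lemma = solve-∀
      gen-ev₂ 2F = lemma
        where
        lemma : ∀ u y → + 3 * u + -[1+ 0 ] * y + + 1 ≡ (+ 3 * u + + 1) * + 1 + y * -[1+ 0 ]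
        lemma = solve-∀

      up≋ : ∀ i x → vec (inj₂ (F i x)) ≋ (vec (inj₁ x) · gen point i)
      up≋ i x = componentwise
        (≈-trans (+-cong-≈ (+ 1) (*-cong-≈ (+ 3) (U-F i x))) (≈-reflexive (gen-ev₁ i (U x) (Y x))))
        (≈-trans (Y-F i x) (≈-reflexive (gen-ev₂ i (U x) (Y x))))

      •-identity : ∀ x → ((+ 1) • x) ≡ x
      •-identity (x , y) = cong₂ _,_ (ℤₚ.*-identityˡ x) (ℤₚ.*-identityˡ y)

      •-· : ∀ t x N → ((t • x) · N) ≡ (t • (x · N))
      •-· t (x , y) (matrix a b c d) = cong₂ _,_ (lemma t x y a c) (lemma t x y b d)
        where
        lemma : ∀ t x y a c → (t * x) * a + (t * y) * c ≡ t * (x * a + y * c)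
        lemma = solve-∀

      •-• : ∀ t t′ x → (t • (t′ • x)) ≡ ((t′ * t) • x)
      •-• t t′ (x , y) = cong₂ _,_ (lemma t t′ x) (lemma t t′ y)
        where
        lemma : ∀ t t′ z → t * (t′ * z) ≡ (t′ * t) * z
        lemma = solve-∀

      •-cong : ∀ t {x y} → x ≋ y → (t • x) ≋ (t • y)
      •-cong t (componentwise d e) = componentwise (*-cong-≈ t d) (*-cong-≈ t e)

      adjugate-inverse : ∀ x N {δ} → det N ≡ δ → ((x · N) · adjugate N) ≡ (δ • x)
      adjugate-inverse (X , Y) (matrix p q r s) refl = cong₂ _,_ (lemma₁ X Y p q r s) (lemma₂ X Y p q r s)
        where
        lemma₁ : ∀ X Y p q r s → (X * p + Y * r) * s + (X * q + Y * s) * (- r) ≡ (p * s - q * r) * X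
        lemma₁ = solve-∀
        lemma₂ : ∀ X Y p q r s → (X * p + Y * r) * (- q) + (X * q + Y * s) * p ≡ (p * s - q * r) * Y
        lemma₂ = solve-∀

      edge≋ : ∀ {i u v} → Edge i u v → (vec u · gen (side u) i) ≋ (τ (side u) • vec v)
      edge≋ {i} (up x)   = ≋-trans (≋-sym (up≋ i x)) (≋-reflexive (≡-sym (•-identity (vec (inj₂ (F i x))))))
      edge≋ {i} (down x) = ≋-trans (·-cong (gen line i) (up≋ i x))
        (≋-reflexive (adjugate-inverse (vec (inj₁ x)) (gen point i) (det-gen point i)))

      ·-⊗ : ∀ x P Q → ((x · P) · Q) ≡ (x · (P ⊗ Q))
      ·-⊗ (x , y) (matrix p q r s) (matrix a b c d) = cong₂ _,_ (lemma x y p q r s a c) (lemma x y p q r s b d)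
        where
        lemma : ∀ x y p q r s a c → (x * p + y * r) * a + (x * q + y * s) * c ≡ x * (p * a + q * c) + y * (r * a + s * c)
        lemma = solve-∀

      ·-step : ∀ x y z t t′ P N → (x · P) ≋ (t • y) → (y · N) ≋ (t′ • z) → (x · (P ⊗ N)) ≋ ((t′ * t) • z)
      ·-step x y z t t′ P N d e =
        ≋-trans (≋-reflexive (≡-sym (·-⊗ x P N)))
        (≋-trans (·-cong N d)
        (≋-trans (≋-reflexive (•-· t y N))
        (≋-trans (•-cong t e) (≋-reflexive (•-• t t′ z)))))

      det-step : ∀ a s t w P N → a * det P ≡ s * (t * t) → det N ≡ w * s →
                 a * det (P ⊗ N) ≡ w * ((s * t) * (s * t))
      det-step a s t w P N eq eq′ = trans (cong (a *_) (trans (det-⊗ P N) (cong (det P *_) eq′)))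
        (trans (lemma₁ a (det P) (w * s)) (trans (cong (_* (w * s)) eq) (lemma₂ s t w)))
        where
        lemma₁ : ∀ a d b → a * (d * b) ≡ (a * d) * b
        lemma₁ = solve-∀
        lemma₂ : ∀ s t w → (s * (t * t)) * (w * s) ≡ w * ((s * t) * (s * t))
        lemma₂ = solve-∀

      -- The factors τ in `det≡` balance trails of odd length, which end on the other side; on a
      -- closed trail they cancel and leave det P = t². Modulo 2, `P` is the outer product of the
      -- vectors of its first and last generator, so `parity` forgets everything in between.
      record Tracked (u : Vertex) (i : Fin 3) (v : Vertex) (j : Fin 3) (k : ℕ) : Set where
        field
          P       : Matrix
          t       : ℤ
          moves   : (vec u · P) ≋ (t • vec v)
          det≡    : τ (side u) * det P ≡ τ (side v) * (t * t)
          1≤t     : 1 ℕ.≤ ∣ t ∣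
          t≤      : ∣ t ∣ ℕ.≤ 4 ℕ.^ k
          bounded : Bounded (4 ℕ.^ k) P
          parity  : let c₁ = κ₁ (side u) i ; c₂ = κ₂ (side u) i
                        ρ₁ = κ₁ (other (side v)) j ; ρ₂ = κ₂ (other (side v)) j
                    in HasParities (c₁ ∧ ρ₁) (c₁ ∧ ρ₂) (c₂ ∧ ρ₁) (c₂ ∧ ρ₂) P

      track : ∀ {u i v j k} → Trail u i v j k → Tracked u i v j k
      track {u} {i} {v} (start e) = record
        { P       = gen (side u) i
        ; t       = τ (side u)
        ; moves   = edge≋ e
        ; det≡    = trans (cong (τ (side u) *_) (trans (det-gen (side u) i) (≡-sym (τ-edge e)))) (lemma (τ (side u)) (τ (side v)))
        ; 1≤t     = 1≤τ (side u)
        ; t≤      = τ≤4 (side u)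
        ; bounded = bounded-gen (side u) i
        ; parity  = subst (λ σ → HasParities (κ₁ (side u) i ∧ κ₁ σ i) (κ₁ (side u) i ∧ κ₂ σ i)
                                             (κ₂ (side u) i ∧ κ₁ σ i) (κ₂ (side u) i ∧ κ₂ σ i) (gen (side u) i))
                          (side-edge e) (gen-parity (side u) i)
        }
        where
        lemma : ∀ a b → a * (b * a) ≡ b * (a * a)
        lemma = solve-∀
      track {u} {i} {w} {j′} {suc k} (extend {v} {j = j} tr e j≢j′) = record
        { P       = P ⊗ gen σ j′
        ; t       = τ σ * t
        ; moves   = ·-step (vec u) (vec v) (vec w) t (τ σ) P (gen σ j′) moves (edge≋ e)
        ; det≡    = det-step (τ (side u)) (τ σ) t (τ (side w)) P (gen σ j′) det≡ (trans (det-gen σ j′) (≡-sym (τ-edge e)))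
        ; 1≤t     = ℕₚ.≤-trans (ℕₚ.*-mono-≤ (1≤τ σ) 1≤t) (ℕₚ.≤-reflexive (≡-sym (ℤₚ.abs-* (τ σ) t)))
        ; t≤      = ℕₚ.≤-trans (ℕₚ.≤-reflexive (ℤₚ.abs-* (τ σ) t)) (ℕₚ.*-mono-≤ (τ≤4 σ) t≤)
        ; bounded = bounded-⊗ P bounded σ j′
        ; parity  = subst (λ σ′ → HasParities (κ₁ (side u) i ∧ κ₁ σ′ j′) (κ₁ (side u) i ∧ κ₂ σ′ j′)
                                              (κ₂ (side u) i ∧ κ₁ σ′ j′) (κ₂ (side u) i ∧ κ₂ σ′ j′) (P ⊗ gen σ j′))
                          (side-edge e)
                          (parity-⊗ (κ₁ (side u) i) (κ₂ (side u) i) (κ₁ (other σ) j) (κ₂ (other σ) j) (κ₁ σ j′) (κ₂ σ j′)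
                                    (column-pairing σ j≢j′) P (gen σ j′) parity (gen-parity σ j′))
        }
        where
        open Tracked (track tr)
        σ = side v

      -- (p − t)(s − t) − q r kills V₁ modulo M and, as det P = t², equals t (2t − (p + s)).
      closed-trail : ∀ {u i j k} → i ≢ j → Trail u i u j k → M ℕ.≤ 4 ℕ.* (4 ℕ.^ k ℕ.* 4 ℕ.^ k)
      closed-trail {u} {i} {j} {k} i≢j tr with track tr
      ... | record { P = matrix p q r s ; t = t ; moves = componentwise (congruent d₁) (congruent d₂) ; det≡ = det≡ ; 1≤t = 1≤t ; t≤ = t≤
                   ; bounded = (p≤ , _) , (_ , s≤) ; parity = (pp , _) , (_ , ps) }
          = ℕₚ.≤-trans (ℕ∣.∣⇒≤ {{D≢0}} (3ᴷ∣-cancel K ∣ D ∣ ∣ V₁ u ∣ 3∤V₁ M∣DV₁)) D≤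
        where
        D : ℤ
        D = t * (+ 2 * t - (p + s))
        det≡t² : p * s - q * r ≡ t * t
        det≡t² = τ-cancel (side u) det≡
        kill : + M ∣ D * V₁ u
        kill = ∣-subst (trans (lemma₁ (V₁ u) (V₂ u) p q r s t)
                 (cong (_* V₁ u) (trans (cong (λ z → z + t * t - t * (p + s)) det≡t²) (lemma₂ t p s))))
                 (∣m∣n⇒∣m-n (∣n⇒∣m*n (s - t) d₁) (∣n⇒∣m*n r d₂))
          where
          lemma₁ : ∀ x y p q r s t → (s - t) * ((x * p + y * r) - t * x) - r * ((x * q + y * s) - t * y) ≡
                   ((p * s - q * r) + t * t - t * (p + s)) * x
          lemma₁ = solve-∀
          lemma₂ : ∀ t p s → t * t + t * t - t * (p + s) ≡ t * (+ 2 * t - (p + s))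
          lemma₂ = solve-∀
        M∣DV₁ : M ℕ∣.∣ ∣ D ∣ ℕ.* ∣ V₁ u ∣
        M∣DV₁ = subst (M ℕ∣.∣_) (ℤₚ.abs-* D (V₁ u)) (∣⇒∣ᵤ kill)
        3∤V₁ : ¬ 3 ℕ∣.∣ ∣ V₁ u ∣
        3∤V₁ d = ℕ∣.>⇒∤ {m = 3} (s≤s (s≤s z≤n)) (∣⇒∣ᵤ {+ 3} {+ 1} (subst (+ 3 ∣_) (lemma (U (base u)))
                   (∣m∣n⇒∣m-n (∣ᵤ⇒∣ {+ 3} {V₁ u} d) (divides (U (base u)) (ℤₚ.*-comm (+ 3) (U (base u)))))))
          where
          lemma : ∀ w → (+ 3 * w + + 1) - + 3 * w ≡ + 1
          lemma = solve-∀
        -- The trace of an outer product is the pairing of its two vectors, here those of the last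
        -- and the first step; `i ≢ j` makes it 1.
        trace-odd : Parity true (p + s)
        trace-odd = subst (λ b → Parity b (p + s)) (trans (cong₂ _xor_ (∧-comm (κ₁ (side u) i) _) (∧-comm (κ₂ (side u) i) _))
                          (column-pairing (side u) (i≢j ∘ ≡-sym)))
                          (parity-+ _ _ pp ps)
        2t-tr≢0 : + 2 * t - (p + s) ≢ + 0
        2t-tr≢0 eq = odd≢2* {b = t} trace-odd (≡-sym (ℤₚ.i-j≡0⇒i≡j (+ 2 * t) (p + s) eq))
        D≢0 : NonZero ∣ D ∣
        D≢0 = ℕ.≢-nonZero λ eq → [ (λ t≡0 → ℕₚ.<⇒≢ 1≤t (≡-sym (cong ∣_∣ t≡0))) , 2t-tr≢0 ]′
                (ℤₚ.i*j≡0⇒i≡0∨j≡0 t (ℤₚ.∣i∣≡0⇒i≡0 eq))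
        B : ℕ
        B = 4 ℕ.^ k
        open ℕₚ.≤-Reasoning
        D≤ : ∣ D ∣ ℕ.≤ 4 ℕ.* (B ℕ.* B)
        D≤ = begin
          ∣ D ∣                                                  ≡⟨ ℤₚ.abs-* t _ ⟩
          ∣ t ∣ ℕ.* ∣ + 2 * t - (p + s) ∣                        ≤⟨ ℕₚ.*-monoʳ-≤ ∣ t ∣ (ℤₚ.∣i-j∣≤∣i∣+∣j∣ (+ 2 * t) (p + s)) ⟩
          ∣ t ∣ ℕ.* (∣ + 2 * t ∣ ℕ.+ ∣ p + s ∣)                  ≤⟨ ℕₚ.*-mono-≤ t≤ (ℕₚ.+-mono-≤
              (ℕₚ.≤-trans (ℕₚ.≤-reflexive (ℤₚ.abs-* (+ 2) t)) (ℕₚ.*-monoʳ-≤ 2 t≤))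
              (ℕₚ.≤-trans (ℤₚ.∣i+j∣≤∣i∣+∣j∣ p s) (ℕₚ.+-mono-≤ p≤ s≤))) ⟩
          B ℕ.* (2 ℕ.* B ℕ.+ (B ℕ.+ B))                          ≡⟨ lemma B ⟩
          4 ℕ.* (B ℕ.* B) ∎
          where
          lemma : ∀ b → b ℕ.* (2 ℕ.* b ℕ.+ (b ℕ.+ b)) ≡ 4 ℕ.* (b ℕ.* b)
          lemma = solveℕ

  high-girth-cubic : ∀ g → Σ (Graph (27 ℕ.^ suc g ℕ.* 27 ℕ.^ suc g ℕ.+ 27 ℕ.^ suc g ℕ.* 27 ℕ.^ suc g)) λ G →
                     Cubic G × GirthAtLeast G g
  high-girth-cubic g = subst (λ M → Σ (Graph (M ℕ.* M ℕ.+ M ℕ.* M)) λ G → Cubic G × GirthAtLeast G g)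
    (≡-sym (ℕₚ.^-*-assoc 3 3 (suc g))) (graph , cubic , girth g short)
    where
    -- A closed trail with k < g edges would force 3^K ≤ 4·16^k. The base 27 = 3³ exceeds 16, and
    -- the additional factor 27 from `suc g` absorbs the 4.
    K = 3 ℕ.* suc g
    open Residues K (+ suc (half3ᴷ K)) (3ᴷ-odd K)
    3ᴷ⁻¹ = 3 ℕ.^ (g ℕ.+ 2 ℕ.* suc g)
    3∣M : + 3 ∣ + (3 ℕ.^ K)
    3∣M = divides (+ 3ᴷ⁻¹) (trans (ℤₚ.pos-* 3 3ᴷ⁻¹) (ℤₚ.*-comm (+ 3) (+ 3ᴷ⁻¹)))
    open BipartiteCubic F F⁻¹ F⁻¹∘F F∘F⁻¹ (F-distinct 3∣M)
    short : ∀ {u i j k} → k ℕ.< g → i ≢ j → Trail u i u j k → ⊥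
    short {k = k} k<g i≢j tr = ℕₚ.<⇒≱ small (closed-trail 3∣M i≢j tr)
      where
      open ℕₚ.≤-Reasoning
      small : 4 ℕ.* (4 ℕ.^ k ℕ.* 4 ℕ.^ k) ℕ.< 3 ℕ.^ K
      small = begin-strict
        4 ℕ.* (4 ℕ.^ k ℕ.* 4 ℕ.^ k)  ≡⟨ cong (4 ℕ.*_) (^-distrib-* 4 4 k) ⟨
        4 ℕ.* 16 ℕ.^ k               ≤⟨ ℕₚ.*-mono-≤ {4} {26} (ℕₚ.≤ᵇ⇒≤ _ _ _) (ℕₚ.≤-trans (ℕₚ.^-monoˡ-≤ k (ℕₚ.≤ᵇ⇒≤ 16 27 _)) (ℕₚ.^-monoʳ-≤ 27 (ℕₚ.<⇒≤ k<g))) ⟩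
        26 ℕ.* 27 ℕ.^ g              <⟨ ℕₚ.*-monoˡ-< (27 ℕ.^ g) {{ℕₚ.m^n≢0 27 g}} (ℕₚ.n<1+n 26) ⟩
        27 ℕ.^ suc g                 ≡⟨ ℕₚ.^-*-assoc 3 3 (suc g) ⟩
        3 ℕ.^ K ∎

-- Growth estimates, logarithms and the two density bounds

module Asymptotics where

  import Data.Nat as ℕ
  open import Data.Nat using (ℕ; zero; suc; _≤_; _<_; _+_; _*_; _^_; z≤n; s≤s)
  open import Data.Nat.Properties
  open import Data.Nat.Tactic.RingSolver using (solve-∀)
  import Data.Integer as ℤ
  import Data.Integer.Properties as ℤₚ
  open import Data.Rational as ℚ using (ℚ; 0ℚ; 1ℚ; ½)
  import Data.Rational.Properties as ℚₚ
  import Data.Rational.Unnormalised as ℚᵘ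
  import Data.Rational.Unnormalised.Properties as ℚᵘₚ
  open Domination
  open CongruenceGraphs using (high-girth-cubic; ^-distrib-*)

  n≤2^n : ∀ n → n ≤ 2 ^ n
  n≤2^n zero    = z≤n
  n≤2^n (suc n) = +-mono-≤ (m^n>0 2 n) (≤-trans (n≤2^n n) (≤-reflexive (≡-sym (+-identityʳ (2 ^ n)))))

  n²≤2^n : ∀ x → (4 + x) * (4 + x) ≤ 2 ^ (4 + x)
  n²≤2^n zero    = ≤-refl
  n²≤2^n (suc x) = begin
    (5 + x) * (5 + x)                                        ≤⟨ m≤m+n _ (7 + 6 * x + x * x) ⟩
    (5 + x) * (5 + x) + (7 + 6 * x + x * x)                  ≡⟨ lemma x ⟩
    2 * ((4 + x) * (4 + x))                                  ≤⟨ *-monoʳ-≤ 2 (n²≤2^n x) ⟩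
    2 * 2 ^ (4 + x)                                          ∎
    where
    open ≤-Reasoning
    lemma : ∀ x → (5 + x) * (5 + x) + (7 + 6 * x + x * x) ≡ 2 * ((4 + x) * (4 + x))
    lemma = solve-∀

  -- For m = 2^e the claim becomes (10 + e) q ≤ 2^e, which follows from e² ≤ 2^e once e ≥ 10 and e ≥
  -- 2q. The factor 2^10 majorises the constant 7·88 = 616 of `ln-bound`.
  exponential-beats-power : ∀ q N → ∃ λ m → 1 ≤ m × N ≤ m × (2 ^ 10 * m) ^ q ≤ 2 ^ m
  exponential-beats-power q N = witness (6 + 2 * q + N) refl
    where
    open ≤-Reasoning
    witness : ∀ x → x ≡ 6 + 2 * q + N → ∃ λ m → 1 ≤ m × N ≤ m × (2 ^ 10 * m) ^ q ≤ 2 ^ m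
    witness x x≡ = 2 ^ (4 + x) , m^n>0 2 (4 + x) , ≤-trans N≤ (n≤2^n (4 + x)) , (begin
      (2 ^ 10 * 2 ^ (4 + x)) ^ q    ≡⟨ cong (_^ q) (^-distribˡ-+-* 2 10 (4 + x)) ⟨
      (2 ^ (10 + (4 + x))) ^ q      ≡⟨ ^-*-assoc 2 (10 + (4 + x)) q ⟩
      2 ^ ((10 + (4 + x)) * q)      ≤⟨ ^-monoʳ-≤ 2 (≤-trans exponent (n²≤2^n x)) ⟩
      2 ^ 2 ^ (4 + x)               ∎)
      where
      N≤ : N ≤ 4 + x
      N≤ = ≤-trans (m≤n+m N (6 + 2 * q)) (≤-trans (≤-reflexive (≡-sym x≡)) (m≤n+m x 4))
      10≤ : 10 ≤ 4 + x
      10≤ = +-monoʳ-≤ 4 (≤-trans (m≤m+n 6 (2 * q + N)) (≤-reflexive (≡-sym (trans x≡ (+-assoc 6 (2 * q) N)))))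
      2q≤ : 2 * q ≤ 4 + x
      2q≤ = ≤-trans (≤-trans (m≤n+m (2 * q) 6) (m≤m+n (6 + 2 * q) N)) (≤-trans (≤-reflexive (≡-sym x≡)) (m≤n+m x 4))
      double : ∀ e q → (e + e) * q ≡ e * (2 * q)
      double = solve-∀
      exponent : (10 + (4 + x)) * q ≤ (4 + x) * (4 + x)
      exponent = begin
        (10 + (4 + x)) * q          ≤⟨ *-monoˡ-≤ q (+-monoˡ-≤ (4 + x) 10≤) ⟩
        ((4 + x) + (4 + x)) * q     ≡⟨ double (4 + x) q ⟩
        (4 + x) * (2 * q)           ≤⟨ *-monoʳ-≤ (4 + x) 2q≤ ⟩
        (4 + x) * (4 + x)           ∎

  -- The order is 2·27^(2(g + 1)), and 27 ≤ 2^5 puts it strictly below 2^(10g + 12) ≤ 2^(22g).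
  cubic-graphs : ∀ g → 1 ≤ g → ∃ λ n → g ≤ n × n < 2 ^ (22 * g) × Σ (Graph n) λ G → Cubic G × GirthAtLeast G g
  cubic-graphs g 1≤g = M * M + M * M , g≤n , n< , high-girth-cubic g
    where
    open ≤-Reasoning
    M = 27 ^ suc g
    M≥1 : 1 ≤ M
    M≥1 = m^n>0 27 (suc g)
    g≤M : g ≤ M
    g≤M = ≤-trans (n≤2^n g) (≤-trans (^-monoˡ-≤ g (≤ᵇ⇒≤ 2 27 _)) (^-monoʳ-≤ 27 (n≤1+n g)))
    g≤n : g ≤ M * M + M * M
    g≤n = ≤-trans g≤M (≤-trans (≤-trans (≤-reflexive (≡-sym (*-identityʳ M))) (*-monoʳ-≤ M M≥1)) (m≤m+n (M * M) (M * M)))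
    M≤ : M ≤ 2 ^ (5 * suc g)
    M≤ = ≤-trans (^-monoˡ-≤ (suc g) (≤ᵇ⇒≤ 27 32 _)) (≤-reflexive (^-*-assoc 2 5 (suc g)))
    B = 2 ^ (5 * suc g)
    double : ∀ b → b * b + b * b ≡ 2 * (b * b)
    double = solve-∀
    exponent : ∀ g → suc (suc (5 * suc g + 5 * suc g)) ≡ 10 * g + 12 * 1
    exponent = solve-∀
    collect : ∀ g → 10 * g + 12 * g ≡ 22 * g
    collect = solve-∀
    n< : M * M + M * M < 2 ^ (22 * g)
    n< = begin-strict
      M * M + M * M                             ≤⟨ +-mono-≤ (*-mono-≤ M≤ M≤) (*-mono-≤ M≤ M≤) ⟩
      B * B + B * B                             ≡⟨ double B ⟩
      2 * (B * B)                               ≡⟨ cong (2 *_) (^-distribˡ-+-* 2 (5 * suc g) (5 * suc g)) ⟨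
      2 ^ suc (5 * suc g + 5 * suc g)           <⟨ ^-monoʳ-< 2 (s≤s (s≤s z≤n)) (n<1+n (suc (5 * suc g + 5 * suc g))) ⟩
      2 ^ suc (suc (5 * suc g + 5 * suc g))     ≡⟨ cong (2 ^_) (exponent g) ⟩
      2 ^ (10 * g + 12 * 1)                     ≤⟨ ^-monoʳ-≤ 2 (+-monoʳ-≤ (10 * g) (*-monoʳ-≤ 12 1≤g)) ⟩
      2 ^ (10 * g + 12 * g)                     ≡⟨ cong (2 ^_) (collect g) ⟩
      2 ^ (22 * g)                              ∎

  -- Partial sums of the exponential series

  reciprocal : ℕ → ℚ
  reciprocal k = ℤ.+ 1 ℚ./ suc k

  toℚᵘ-reciprocal : ∀ k → ℚ.toℚᵘ (reciprocal k) ℚᵘ.≃ ℚᵘ.mkℚᵘ (ℤ.+ 1) k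
  toℚᵘ-reciprocal k = ℚₚ.toℚᵘ-fromℚᵘ (ℚᵘ.mkℚᵘ (ℤ.+ 1) k)

  reciprocal-nonNeg : ∀ k → 0ℚ ℚ.≤ reciprocal k
  reciprocal-nonNeg k = ℚₚ.toℚᵘ-cancel-≤ (ℚᵘₚ.≤-respʳ-≃ (ℚᵘₚ.≃-sym (toℚᵘ-reciprocal k)) (ℚᵘ.*≤* (ℤ.+≤+ z≤n)))

  reciprocal≤½ : ∀ k → reciprocal (suc k) ℚ.≤ ½
  reciprocal≤½ k = ℚₚ.toℚᵘ-cancel-≤ (ℚᵘₚ.≤-respˡ-≃ (ℚᵘₚ.≃-sym (toℚᵘ-reciprocal (suc k))) (ℚᵘ.*≤* (ℤ.+≤+ (s≤s (s≤s z≤n)))))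

  nq*reciprocal : ∀ k → nq (suc k) ℚ.* reciprocal k ≡ 1ℚ
  nq*reciprocal k = ℚₚ.toℚᵘ-injective (begin
    ℚ.toℚᵘ (nq (suc k) ℚ.* reciprocal k)                        ≈⟨ ℚₚ.toℚᵘ-homo-* (nq (suc k)) (reciprocal k) ⟩
    ℚ.toℚᵘ (nq (suc k)) ℚᵘ.* ℚ.toℚᵘ (reciprocal k)              ≈⟨ ℚᵘₚ.*-cong (toℚᵘ-nq (suc k)) (toℚᵘ-reciprocal k) ⟩
    ℚᵘ.mkℚᵘ (ℤ.+ suc k) 0 ℚᵘ.* ℚᵘ.mkℚᵘ (ℤ.+ 1) k                ≈⟨ ℚᵘ.*≡* (cong ℤ.+_ (lemma k)) ⟩
    ℚ.toℚᵘ 1ℚ ∎)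
    where
    open ℚᵘₚ.≃-Reasoning
    lemma : ∀ k → (1 + k) * 1 * 1 ≡ (1 + (k + 0)) + 0
    lemma = solve-∀

  expTerm-nonNeg : ∀ {t} → 0ℚ ℚ.≤ t → ∀ k → 0ℚ ℚ.≤ expTerm t k
  expTerm-nonNeg 0≤t zero    = 0≤nq 1
  expTerm-nonNeg 0≤t (suc k) = *-nonNeg (expTerm-nonNeg 0≤t k) (*-nonNeg 0≤t (reciprocal-nonNeg k))

  expSum-nonNeg : ∀ {t} → 0ℚ ℚ.≤ t → ∀ k → 0ℚ ℚ.≤ expSum t k
  expSum-nonNeg 0≤t zero    = ℚₚ.≤-refl
  expSum-nonNeg 0≤t (suc k) = ℚₚ.+-mono-≤ (expSum-nonNeg 0≤t k) (expTerm-nonNeg 0≤t k)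

  *-mono-≤-nonNeg : ∀ {a b c d} → 0ℚ ℚ.≤ c → 0ℚ ℚ.≤ b → a ℚ.≤ b → c ℚ.≤ d → a ℚ.* c ℚ.≤ b ℚ.* d
  *-mono-≤-nonNeg 0≤c 0≤b a≤b c≤d = ℚₚ.≤-trans (≤-*ʳ 0≤c a≤b) (≤-*ˡ 0≤b c≤d)

  expTerm-mono : ∀ {s t} → 0ℚ ℚ.≤ s → s ℚ.≤ t → ∀ k → expTerm s k ℚ.≤ expTerm t k
  expTerm-mono 0≤s s≤t zero    = ℚₚ.≤-refl
  expTerm-mono 0≤s s≤t (suc k) = *-mono-≤-nonNeg (*-nonNeg 0≤s (reciprocal-nonNeg k)) (expTerm-nonNeg (ℚₚ.≤-trans 0≤s s≤t) k)
    (expTerm-mono 0≤s s≤t k) (≤-*ʳ (reciprocal-nonNeg k) s≤t)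

  expSum-mono : ∀ {s t} → 0ℚ ℚ.≤ s → s ℚ.≤ t → ∀ k → expSum s k ℚ.≤ expSum t k
  expSum-mono 0≤s s≤t zero    = ℚₚ.≤-refl
  expSum-mono 0≤s s≤t (suc k) = ℚₚ.+-mono-≤ (expSum-mono 0≤s s≤t k) (expTerm-mono 0≤s s≤t k)

  ⅔ : ℚ
  ⅔ = ℤ.+ 2 ℚ./ 3

  0≤⅔ : 0ℚ ℚ.≤ ⅔
  0≤⅔ = ℚₚ.≤ᵇ⇒≤ _

  -- From the third term on each term of the series at ⅔ is at most half the previous one,
  -- so the tail after K terms is at most twice the K-th term.
  expSum-⅔-tail : ∀ j → expSum ⅔ (3 + j) ℚ.+ (expTerm ⅔ (3 + j) ℚ.+ expTerm ⅔ (3 + j)) ℚ.≤ nq 2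
  expSum-⅔-tail zero    = ℚₚ.≤ᵇ⇒≤ _
  expSum-⅔-tail (suc j) = ℚₚ.≤-trans step (expSum-⅔-tail j)
    where
    open ℚₚ.≤-Reasoning
    a = expTerm ⅔ (3 + j)
    0≤a : 0ℚ ℚ.≤ a
    0≤a = expTerm-nonNeg 0≤⅔ (3 + j)
    halves : expTerm ⅔ (4 + j) ℚ.≤ a ℚ.* ½
    halves = ≤-*ˡ 0≤a (ℚₚ.≤-trans
      (*-mono-≤-nonNeg (reciprocal-nonNeg (3 + j)) (0≤nq 1) (ℚₚ.≤ᵇ⇒≤ {⅔} {1ℚ} _) (reciprocal≤½ (2 + j)))
      (ℚₚ.≤-reflexive (ℚₚ.*-identityˡ ½)))
    step : expSum ⅔ (3 + j) ℚ.+ a ℚ.+ (expTerm ⅔ (4 + j) ℚ.+ expTerm ⅔ (4 + j)) ℚ.≤ expSum ⅔ (3 + j) ℚ.+ (a ℚ.+ a)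
    step = begin
      expSum ⅔ (3 + j) ℚ.+ a ℚ.+ (expTerm ⅔ (4 + j) ℚ.+ expTerm ⅔ (4 + j)) ≡⟨ ℚₚ.+-assoc (expSum ⅔ (3 + j)) a _ ⟩
      expSum ⅔ (3 + j) ℚ.+ (a ℚ.+ (expTerm ⅔ (4 + j) ℚ.+ expTerm ⅔ (4 + j))) ≤⟨ ℚₚ.+-monoʳ-≤ (expSum ⅔ (3 + j)) (ℚₚ.+-monoʳ-≤ a (ℚₚ.+-mono-≤ halves halves)) ⟩
      expSum ⅔ (3 + j) ℚ.+ (a ℚ.+ (a ℚ.* ½ ℚ.+ a ℚ.* ½))  ≡⟨ cong (λ z → expSum ⅔ (3 + j) ℚ.+ (a ℚ.+ z)) (ℚₚ.*-distribˡ-+ a ½ ½) ⟨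
      expSum ⅔ (3 + j) ℚ.+ (a ℚ.+ a ℚ.* (½ ℚ.+ ½))        ≡⟨ cong (λ z → expSum ⅔ (3 + j) ℚ.+ (a ℚ.+ z)) (ℚₚ.*-identityʳ a) ⟩
      expSum ⅔ (3 + j) ℚ.+ (a ℚ.+ a) ∎

  p≤p+q : ∀ {p q} → 0ℚ ℚ.≤ q → p ℚ.≤ p ℚ.+ q
  p≤p+q {p} {q} 0≤q = ℚₚ.≤-trans (ℚₚ.≤-reflexive (≡-sym (ℚₚ.+-identityʳ p))) (ℚₚ.+-monoʳ-≤ p 0≤q)

  expSum-≤-+ : ∀ {t} → 0ℚ ℚ.≤ t → ∀ a b → expSum t b ℚ.≤ expSum t (a + b)
  expSum-≤-+ 0≤t zero    b = ℚₚ.≤-refl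
  expSum-≤-+ 0≤t (suc a) b = ℚₚ.≤-trans (expSum-≤-+ 0≤t a b) (p≤p+q (expTerm-nonNeg 0≤t (a + b)))

  expSum-⅔≤2 : ∀ K → expSum ⅔ K ℚ.≤ nq 2
  expSum-⅔≤2 K = ℚₚ.≤-trans (expSum-≤-+ 0≤⅔ 3 K) (ℚₚ.≤-trans
    (p≤p+q (ℚₚ.+-mono-≤ (expTerm-nonNeg 0≤⅔ (3 + K)) (expTerm-nonNeg 0≤⅔ (3 + K)))) (expSum-⅔-tail K))

  -- `LnLt` provides one partial sum above 2, whereas all partial sums at ⅔ stay at most 2;
  -- monotonicity of each partial sum carries this bound to every smaller nonnegative t.
  ln2>⅔ : ∀ {t} → LnLt (nq 2) t → ⅔ ℚ.< t
  ln2>⅔ {t} (0≤t , K , 2<) = ℚₚ.≰⇒> λ t≤⅔ →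
    ℚₚ.<-irrefl refl (ℚₚ.<-≤-trans 2< (ℚₚ.≤-trans (expSum-mono 0≤t t≤⅔ K) (expSum-⅔≤2 K)))

  -- For t ≥ 2L the first L ratios t / (c + 1) of consecutive terms are at least 2, so the single
  -- term t^L / L! already reaches 2^L. This suffices for a crude logarithm bound.
  pow≤expTerm : ∀ {t} L → nq (2 * L) ℚ.≤ t → ∀ c → c ≤ L → nq (2 ^ c) ℚ.≤ expTerm t c
  pow≤expTerm         L 2L≤t zero    _   = ℚₚ.≤-refl
  pow≤expTerm {t} L 2L≤t (suc c) c<L = begin
    nq (2 * 2 ^ c)                                   ≡⟨ cong nq (*-comm 2 (2 ^ c)) ⟩
    nq (2 ^ c * 2)                                   ≡⟨ nq-* (2 ^ c) 2 ⟩
    nq (2 ^ c) ℚ.* nq 2                              ≤⟨ *-mono-≤-nonNeg (0≤nq 2) (expTerm-nonNeg 0≤t c) (pow≤expTerm L 2L≤t c (<⇒≤ c<L)) 2≤ ⟩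
    expTerm t c ℚ.* (t ℚ.* reciprocal c) ∎
    where
    open ℚₚ.≤-Reasoning
    0≤t : 0ℚ ℚ.≤ t
    0≤t = ℚₚ.≤-trans (0≤nq (2 * L)) 2L≤t
    2≤ : nq 2 ℚ.≤ t ℚ.* reciprocal c
    2≤ = begin
      nq 2                                           ≡⟨ ℚₚ.*-identityʳ (nq 2) ⟨
      nq 2 ℚ.* 1ℚ                                    ≡⟨ cong (nq 2 ℚ.*_) (nq*reciprocal c) ⟨
      nq 2 ℚ.* (nq (suc c) ℚ.* reciprocal c)         ≡⟨ ℚₚ.*-assoc (nq 2) (nq (suc c)) (reciprocal c) ⟨
      nq 2 ℚ.* nq (suc c) ℚ.* reciprocal c           ≡⟨ cong (ℚ._* reciprocal c) (nq-* 2 (suc c)) ⟨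
      nq (2 * suc c) ℚ.* reciprocal c                ≤⟨ ≤-*ʳ (reciprocal-nonNeg c) (ℚₚ.≤-trans (nq-mono-≤ (*-monoʳ-≤ 2 c<L)) 2L≤t) ⟩
      t ℚ.* reciprocal c ∎

  nq-mono-< : ∀ {a b} → a < b → nq a ℚ.< nq b
  nq-mono-< {a} {b} a<b = ℚₚ.toℚᵘ-cancel-<
    (ℚᵘₚ.<-respˡ-≃ (ℚᵘₚ.≃-sym (toℚᵘ-nq a)) (ℚᵘₚ.<-respʳ-≃ (ℚᵘₚ.≃-sym (toℚᵘ-nq b))
      (ℚᵘ.*<* (ℤₚ.*-monoʳ-<-pos (ℤ.+ 1) (ℤ.+<+ a<b)))))

  log₂-bound : ∀ {n t} L → n < 2 ^ L → nq (2 * L) ℚ.≤ t → LnLt (nq n) t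
  log₂-bound {n} {t} L n<2^L 2L≤t = 0≤t , suc L , (begin-strict
    nq n             <⟨ nq-mono-< n<2^L ⟩
    nq (2 ^ L)       ≤⟨ pow≤expTerm L 2L≤t L ≤-refl ⟩
    expTerm t L      ≡⟨ ℚₚ.+-identityˡ _ ⟨
    0ℚ ℚ.+ expTerm t L ≤⟨ ℚₚ.+-monoˡ-≤ (expTerm t L) (expSum-nonNeg 0≤t L) ⟩
    expSum t (suc L) ∎)
    where
    open ℚₚ.≤-Reasoning
    0≤t : 0ℚ ℚ.≤ t
    0≤t = ℚₚ.≤-trans (0≤nq (2 * L)) 2L≤t

  qpow-nonNeg : ∀ {x} → 0ℚ ℚ.≤ x → ∀ k → 0ℚ ℚ.≤ qpow x k
  qpow-nonNeg 0≤x zero    = 0≤nq 1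
  qpow-nonNeg 0≤x (suc k) = *-nonNeg 0≤x (qpow-nonNeg 0≤x k)

  qpow-mono : ∀ {x y} → 0ℚ ℚ.≤ x → x ℚ.≤ y → ∀ k → qpow x k ℚ.≤ qpow y k
  qpow-mono 0≤x x≤y zero    = ℚₚ.≤-refl
  qpow-mono 0≤x x≤y (suc k) = *-mono-≤-nonNeg (qpow-nonNeg 0≤x k) (ℚₚ.≤-trans 0≤x x≤y) x≤y (qpow-mono 0≤x x≤y k)

  qpow-nq : ∀ a k → qpow (nq a) k ≡ nq (a ^ k)
  qpow-nq a zero    = refl
  qpow-nq a (suc k) = trans (cong (nq a ℚ.*_) (qpow-nq a k)) (≡-sym (nq-* a (a ^ k)))

  -- The rational t lies above ln 2, hence above ⅔, so 2p = 3p·⅔ < 3pt ≤ 2q.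
  α<1 : ∀ p q → 0 < p → (∃ λ t → LnLt (nq 2) t × nq 3 ℚ.* nq p ℚ.* t ℚ.≤ nq 2 ℚ.* nq q) → p < q
  α<1 p q 0<p (t , ln2<t , 3pt≤2q) = *-cancelˡ-< 2 p q (nq-cancel-< (begin-strict
    nq (2 * p)                  ≡⟨ nq-* 2 p ⟩
    nq 3 ℚ.* ⅔ ℚ.* nq p         ≡⟨ ℚₚ.*-assoc (nq 3) ⅔ (nq p) ⟩
    nq 3 ℚ.* (⅔ ℚ.* nq p)       ≡⟨ cong (nq 3 ℚ.*_) (ℚₚ.*-comm ⅔ (nq p)) ⟩
    nq 3 ℚ.* (nq p ℚ.* ⅔)       ≡⟨ ℚₚ.*-assoc (nq 3) (nq p) ⅔ ⟨
    nq 3 ℚ.* nq p ℚ.* ⅔         <⟨ ℚₚ.*-monoʳ-<-pos (nq 3 ℚ.* nq p) {{positive}} (ln2>⅔ ln2<t) ⟩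
    nq 3 ℚ.* nq p ℚ.* t         ≤⟨ 3pt≤2q ⟩
    nq 2 ℚ.* nq q               ≡⟨ nq-* 2 q ⟨
    nq (2 * q) ∎))
    where
    open ℚₚ.≤-Reasoning
    positive : ℚ.Positive (nq 3 ℚ.* nq p)
    positive = ℚ.positive (ℚₚ.<-respʳ-≡ (nq-* 3 p) (nq-mono-< {0} {3 * p} (*-mono-≤ {1} {3} (s≤s z≤n) 0<p)))

  -- If t ≤ D = 88 m 2^m, then t^p is at most (2^m / 7)^q because p < q and m is large, whereas 3n/k ≥ (6/7) 2^m.
  ln-bound : ∀ {n k} p q m → p < q → 1 ≤ m → (2 ^ 10 * m) ^ q ≤ 2 ^ m → 0 < n →
    n < 2 ^ (22 * (2 * (m * 2 ^ m))) → k * 2 ^ suc m ≤ 7 * n →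
    ∀ t → 0ℚ ℚ.≤ t → qpow (nq 3 ℚ.* nq n) q ℚ.< qpow (nq k) q ℚ.* qpow t p → LnLt (nq n) t
  ln-bound {n} {k} p q m p<q 1≤m m-large 0<n n< kbound t 0≤t hyp
    = [ log₂-bound (22 * (2 * (m * 2 ^ m))) n< , (λ t≤D → ⊥-elim (<⇒≱ (natural t≤D) impossible)) ]′ (ℚₚ.≤-total (nq D) t)
    where
    open ≤-Reasoning
    Q = 2 ^ m
    -- Twice the exponent in the bound on n, as `log₂-bound` requires; beyond `D` the conclusion
    -- holds outright.
    D = 2 * (22 * (2 * (m * Q)))
    natural : t ℚ.≤ nq D → (3 * n) ^ q < k ^ q * D ^ p
    natural t≤D = nq-cancel-< (ℚₚ.<-≤-trans
      (ℚₚ.<-respˡ-≡ (trans (cong (λ z → qpow z q) (≡-sym (nq-* 3 n))) (qpow-nq (3 * n) q)) hyp)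
      (ℚₚ.≤-trans (*-mono-≤-nonNeg (qpow-nonNeg 0≤t p) (0≤nq (k ^ q)) (ℚₚ.≤-reflexive (qpow-nq k q))
                    (ℚₚ.≤-trans (qpow-mono 0≤t t≤D p) (ℚₚ.≤-reflexive (qpow-nq D p))))
                  (ℚₚ.≤-reflexive (≡-sym (nq-* (k ^ q) (D ^ p))))))
    D≡ : ∀ m Q → 2 * (22 * (2 * (m * Q))) ≡ (88 * m) * Q
    D≡ = solve-∀
    regroup : ∀ a b c → a * b * c ≡ a * c * b
    regroup = solve-∀
    instance
      _ = ℕ.>-nonZero 1≤m
      _ = ℕ.>-nonZero 0<n
    7D≤ : 7 ^ q * D ^ p ≤ Q ^ q
    7D≤ = begin
      7 ^ q * D ^ p                      ≡⟨ cong (λ d → 7 ^ q * d ^ p) (D≡ m Q) ⟩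
      7 ^ q * (88 * m * Q) ^ p           ≡⟨ cong (7 ^ q *_) (^-distrib-* (88 * m) Q p) ⟩
      7 ^ q * ((88 * m) ^ p * Q ^ p)     ≡⟨ *-assoc (7 ^ q) ((88 * m) ^ p) (Q ^ p) ⟨
      7 ^ q * (88 * m) ^ p * Q ^ p       ≤⟨ *-monoˡ-≤ (Q ^ p) (*-monoʳ-≤ (7 ^ q) (^-monoʳ-≤ (88 * m) {{m*n≢0 88 m}} (<⇒≤ p<q))) ⟩
      7 ^ q * (88 * m) ^ q * Q ^ p       ≡⟨ cong (_* Q ^ p) (^-distrib-* 7 (88 * m) q) ⟨
      (7 * (88 * m)) ^ q * Q ^ p         ≤⟨ *-monoˡ-≤ (Q ^ p) (^-monoˡ-≤ q (≤-trans (≤-reflexive (≡-sym (*-assoc 7 88 m))) (*-monoˡ-≤ m (≤ᵇ⇒≤ 616 1024 _)))) ⟩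
      (2 ^ 10 * m) ^ q * Q ^ p           ≤⟨ *-monoˡ-≤ (Q ^ p) m-large ⟩
      Q ^ suc p                          ≤⟨ ^-monoʳ-≤ Q {{m^n≢0 2 m}} p<q ⟩
      Q ^ q ∎
    impossible : k ^ q * D ^ p ≤ (3 * n) ^ q
    impossible = *-cancelʳ-≤ _ _ ((2 ^ suc m) ^ q) {{m^n≢0 (2 ^ suc m) q {{m^n≢0 2 (suc m)}}}} (begin
      k ^ q * D ^ p * (2 ^ suc m) ^ q      ≡⟨ regroup (k ^ q) (D ^ p) ((2 ^ suc m) ^ q) ⟩
      k ^ q * (2 ^ suc m) ^ q * D ^ p      ≡⟨ cong (_* D ^ p) (^-distrib-* k (2 ^ suc m) q) ⟨
      (k * 2 ^ suc m) ^ q * D ^ p        ≤⟨ *-monoˡ-≤ (D ^ p) (^-monoˡ-≤ q kbound) ⟩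
      (7 * n) ^ q * D ^ p                ≡⟨ cong (_* D ^ p) (^-distrib-* 7 n q) ⟩
      7 ^ q * n ^ q * D ^ p              ≡⟨ regroup (7 ^ q) (n ^ q) (D ^ p) ⟩
      7 ^ q * D ^ p * n ^ q              ≤⟨ *-monoˡ-≤ (n ^ q) 7D≤ ⟩
      Q ^ q * n ^ q                      ≤⟨ *-mono-≤ (^-monoˡ-≤ q (m≤m+n Q (Q + 0))) (^-monoˡ-≤ q (m≤m+n n (n + (n + 0)))) ⟩
      (2 ^ suc m) ^ q * (3 * n) ^ q        ≡⟨ *-comm ((2 ^ suc m) ^ q) ((3 * n) ^ q) ⟩
      (3 * n) ^ q * (2 ^ suc m) ^ q ∎)

  1≤ε*denominator : ∀ ε → 0ℚ ℚ.< ε → 1ℚ ℚ.≤ ε ℚ.* nq (ℚ.↧ₙ ε)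
  1≤ε*denominator ε@(ℚ.mkℚ (ℤ.+ suc a) d _) _ = ℚₚ.toℚᵘ-cancel-≤
    (ℚᵘₚ.≤-respʳ-≃ (ℚᵘₚ.≃-sym (ℚᵘₚ.≃-trans (ℚₚ.toℚᵘ-homo-* ε (nq (suc d))) (ℚᵘₚ.*-congˡ {ℚ.toℚᵘ ε} (toℚᵘ-nq (suc d)))))
      (ℚᵘ.*≤* (ℤ.+≤+ (begin
        1 * (suc d * 1)            ≡⟨ trans (*-identityˡ (suc d * 1)) (*-identityʳ (suc d)) ⟩
        suc d                      ≤⟨ m≤m+n (suc d) (a * suc d) ⟩
        suc a * suc d              ≡⟨ *-identityʳ (suc a * suc d) ⟨
        suc a * suc d * 1 ∎))))
    where
    open ≤-Reasoning
  1≤ε*denominator (ℚ.mkℚ (ℤ.+ zero) d _) (ℚ.*<* (ℤ.+<+ ()))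
  1≤ε*denominator (ℚ.mkℚ ℤ.-[1+ a ] d _) (ℚ.*<* ())

  ε-bound : ∀ ε → 0ℚ ℚ.< ε → ∀ {k n} → k * ℚ.↧ₙ ε ≤ n → nq k ℚ.≤ ε ℚ.* nq n
  ε-bound ε 0<ε {k} {n} kb≤n = begin
    nq k                            ≡⟨ ℚₚ.*-identityˡ (nq k) ⟨
    1ℚ ℚ.* nq k                     ≤⟨ ≤-*ʳ (0≤nq k) (1≤ε*denominator ε 0<ε) ⟩
    ε ℚ.* nq b ℚ.* nq k             ≡⟨ ℚₚ.*-assoc ε (nq b) (nq k) ⟩
    ε ℚ.* (nq b ℚ.* nq k)           ≡⟨ cong (ε ℚ.*_) (nq-* b k) ⟨
    ε ℚ.* nq (b * k)                ≤⟨ ≤-*ˡ (ℚₚ.<⇒≤ 0<ε) (nq-mono-≤ (≤-trans (≤-reflexive (*-comm b k)) kb≤n)) ⟩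
    ε ℚ.* nq n ∎
    where
    open ℚₚ.≤-Reasoning
    b = ℚ.↧ₙ ε

  small-density : ∀ (ε : ℚ) → 0ℚ ℚ.< ε → ∃ λ (g : ℕ) → ∀ (n : ℕ) (G : Graph n) → Cubic G → GirthAtLeast G g →
    ∀ k → IsExpDomNumber G k → nq k ℚ.≤ ε ℚ.* nq n
  small-density ε 0<ε = 2 * (m * 2 ^ m) , λ n G cubic girth k dom →
    ε-bound ε 0<ε {k} {n} (*-cancelʳ-≤ _ _ 7 (begin
      k * b * 7          ≡⟨ *-assoc k b 7 ⟩
      k * (b * 7)        ≤⟨ *-monoʳ-≤ k 7b≤ ⟩
      k * 2 ^ suc m      ≤⟨ domination-bound G cubic m (s≤s z≤n) girth k dom ⟩
      7 * n              ≡⟨ *-comm 7 n ⟩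
      n * 7 ∎))
    where
    open ≤-Reasoning
    b = ℚ.↧ₙ ε
    -- `domination-bound` gives k ≤ 7n / 2^(m + 1), and 7b ≤ 2^3·2^b = 2^(m + 1) brings this down to
    -- n / b; a positive ε with denominator b is at least 1 / b.
    m = 2 + b
    7b≤ : b * 7 ≤ 2 ^ suc m
    7b≤ = begin
      b * 7              ≤⟨ *-mono-≤ (n≤2^n b) (≤ᵇ⇒≤ 7 8 _) ⟩
      2 ^ b * 2 ^ 3      ≡⟨ ^-distribˡ-+-* 2 b 3 ⟨
      2 ^ (b + 3)        ≡⟨ cong (2 ^_) (+-comm b 3) ⟩
      2 ^ suc m ∎

  -- Read contrapositively and with q-th roots taken, the last clause is k t^α ≤ 3n for all rational
  -- t between 0 and ln n, where α = p / q. This expresses the bound without real numbers.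
  logarithmic-density : ∀ (p q : ℕ) → 0 < p → 0 < q →
    (∃ λ (t : ℚ) → LnLt (nq 2) t × nq 3 ℚ.* nq p ℚ.* t ℚ.≤ nq 2 ℚ.* nq q) →
    ∀ (N : ℕ) → ∃ λ (n : ℕ) → N ≤ n × Σ (Graph n) λ G → Cubic G ×
      (∀ k → IsExpDomNumber G k → ∀ (t : ℚ) → 0ℚ ℚ.≤ t →
        qpow (nq 3 ℚ.* nq n) q ℚ.< qpow (nq k) q ℚ.* qpow t p → LnLt (nq n) t)
  logarithmic-density p q 0<p 0<q hyp N = choose (exponential-beats-power q N)
    where
    choose : (∃ λ m → 1 ≤ m × N ≤ m × (2 ^ 10 * m) ^ q ≤ 2 ^ m) → _
    choose (m , 1≤m , N≤m , large) = conclude (cubic-graphs g (≤-trans 1≤m m≤g))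
      where
      g = 2 * (m * 2 ^ m)
      m≤g : m ≤ g
      m≤g = ≤-trans (≤-trans (≤-reflexive (≡-sym (*-identityʳ m))) (*-monoʳ-≤ m (m^n>0 2 m))) (m≤m+n (m * 2 ^ m) _)
      conclude : (∃ λ n → g ≤ n × n < 2 ^ (22 * g) × Σ (Graph n) λ G → Cubic G × GirthAtLeast G g) → _
      conclude (n , g≤n , n< , G , cubic , girth) = n , ≤-trans N≤m (≤-trans m≤g g≤n) , G , cubic , λ k dom →
        ln-bound {n} {k} p q m (α<1 p q 0<p hyp) 1≤m large (≤-trans 1≤m (≤-trans m≤g g≤n)) n< (domination-bound G cubic m 1≤m girth k dom)

open import Data.Nat using (ℕ; _≤_; _<_)
open import Data.Rational using (ℚ; 0ℚ; _*_)
open import Data.Rational using () renaming (_≤_ to _≤ℚ_; _<_ to _<ℚ_)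

theorem5 : ((ε : ℚ) → 0ℚ <ℚ ε →
    ∃ λ (g : ℕ) → ∀ (n : ℕ) (G : Graph n) → Cubic G → GirthAtLeast G g →
    ∀ k → IsExpDomNumber G k → nq k ≤ℚ ε * nq n)
    ×
    (∀ (p q : ℕ) → 0 < p → 0 < q →
    (∃ λ (t : ℚ) → LnLt (nq 2) t × nq 3 * nq p * t ≤ℚ nq 2 * nq q) →
    ∀ (N : ℕ) → ∃ λ (n : ℕ) → N ≤ n × Σ (Graph n) λ G → Cubic G ×
    (∀ k → IsExpDomNumber G k →
    ∀ (t : ℚ) → 0ℚ ≤ℚ t →
    qpow (nq 3 * nq n) q <ℚ qpow (nq k) q * qpow t p →
    LnLt (nq n) t))
theorem5 = Asymptotics.small-density , Asymptotics.logarithmic-density
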